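{- Let $t$ be the morphism on $\{0,1,2\}^*$ defined by $t(0)=01120$, $t(1)=12001$, $t(2)=2$, and let $t^\omega(0)$ be its infinite fixed point starting with $0$. Then $t^\omega(0)$ contains exactly $6$ distinct palindromes (including the empty word) and is $2^+$-free. Moreover, every bi-infinite word over $\{0,1,2\}$ that is $\tfrac94$-free and contains at most $6$ distinct palindromes (including the empty word) has the same set of finite factors as one of the six words obtained from $t^\omega(0)$ by applying a permutation of the letters $\{0,1,2\}$.
   Context: For a nonempty finite word $u$ and a rational $r>1$, a word $v$ is an $r$-power (of $u$) if $v$ is a prefix of the infinite periodic word $uuu\cdots$ and $|v|/|u|=r$. A (finite, infinite or bi-infinite) word is $\beta$-free (resp. $\beta^+$-free) if none of its factors is an $r$-power with $r\ge\beta$ (resp. $r>\beta$). A palindrome is a finite word equal to its reversal; a word contains a palindrome if the palindrome is one of its factors. A morphism satisfies $t(uv)=t(u)t(v)$ for all words $u,v$; since $t(0)$ begins with $0$, $t^\omega(0)=\lim_{n\to\infty}t^n(0)$ is well defined. -}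

module Defs where

open import Data.Fin using (Fin; toℕ; fromℕ<)
open import Data.Fin.Patterns using (0F; 1F; 2F)
open import Data.Fin.Permutation using (Permutation′; _⟨$⟩ʳ_)
open import Data.Fin.Properties using (toℕ-fromℕ<)
open import Data.Integer as ℤ using (ℤ; +_)
open import Data.List using (List; []; _∷_; _++_; length; lookup; reverse; concatMap)
open import Data.List.NonEmpty as List⁺ using (List⁺)
open import Data.List.Properties using (concatMap-++; ++-assoc; ++-identityʳ)
open import Data.List.Relation.Unary.All using (All)
open import Data.List.Relation.Unary.Unique.Propositional using (Unique)
import Data.List.Membership.Propositional as List
open import Data.Nat as ℕ using (ℕ; zero; suc; _+_; _≤_; _<_; s≤s; z≤n)
open import Data.Nat.DivMod using (_mod_)
open import Data.Nat.GeneralisedArithmetic using (fold)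
import Data.Nat.Properties as ℕ
open import Data.Product using (∃-syntax; _×_; _,_)
open import Data.Rational as ℚ using (ℚ; 1ℚ)
open import Data.Sum using (inj₁; inj₂)
open import Function using (_⇔_)
open import Level using (0ℓ)
open import Relation.Binary.PropositionalEquality using (_≡_; refl; sym; trans; cong; subst)
open import Relation.Nullary using (¬_)
open import Relation.Unary using (Pred; _∈_; _∩_)

Infinite BiInfinite : Set → Set
Infinite   A = ℕ → A
BiInfinite A = ℤ → A

module _ {A : Set} where

  infix 4 _IsPrefixOf_

  _IsPrefixOf_ : List A → Infinite A → Set
  u IsPrefixOf x = ∀ i → lookup u i ≡ x (toℕ i)

  Factors : Infinite A → Pred (List A) 0ℓ
  Factors x u = ∃[ n ] u IsPrefixOf (λ k → x (n + k))

  Factorsℤ : BiInfinite A → Pred (List A) 0ℓ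
  Factorsℤ w u = ∃[ n ] u IsPrefixOf (λ k → w (n ℤ.+ + k))

  -- The infinite word u u u ⋯
  periodic : List⁺ A → Infinite A
  periodic u n = lookup (List⁺.toList u) (n mod List⁺.length u)

  IsPower : ℚ → List⁺ A → List A → Set
  IsPower r u v =
    1ℚ ℚ.< r × v IsPrefixOf periodic u × (+ length v) ℚ./ List⁺.length u ≡ r

  -- Freeness and palindromes of a word depend only on its set of factors L.
  Free Free⁺ : ℚ → Pred (List A) 0ℓ → Set
  Free  β L = ∀ u v r → v ∈ L → IsPower r u v → ¬ (r ℚ.≥ β)
  Free⁺ β L = ∀ u v r → v ∈ L → IsPower r u v → ¬ (r ℚ.> β)

  Palindrome : Pred (List A) 0ℓ
  Palindrome u = reverse u ≡ u

  Palindromes : Pred (List A) 0ℓ → Pred (List A) 0ℓ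
  Palindromes L = L ∩ Palindrome

HasSize : {B : Set} → Pred B 0ℓ → ℕ → Set
HasSize P n = ∃[ xs ] (Unique xs × (∀ x → (x List.∈ xs) ⇔ (x ∈ P)) × length xs ≡ n)

HasSizeAtMost : {B : Set} → Pred B 0ℓ → ℕ → Set
HasSizeAtMost P n = ∀ xs → Unique xs → All P xs → length xs ≤ n

Letter : Set
Letter = Fin 3

t : Letter → List Letter
t 0F = 0F ∷ 1F ∷ 1F ∷ 2F ∷ 0F ∷ []
t 1F = 1F ∷ 2F ∷ 0F ∷ 0F ∷ 1F ∷ []
t 2F = 2F ∷ []

t* : List Letter → List Letter
t* = concatMap t

t^_[0] : ℕ → List Letter
t^ n [0] = fold (0F ∷ []) t* n

private
  length-t* : ∀ u → length u ≤ length (t* u)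
  length-t* []       = z≤n
  length-t* (0F ∷ u) = s≤s (ℕ.m≤n⇒m≤o+n 4 (length-t* u))
  length-t* (1F ∷ u) = s≤s (ℕ.m≤n⇒m≤o+n 4 (length-t* u))
  length-t* (2F ∷ u) = s≤s (length-t* u)

  starts-with-0 : ∀ n → ∃[ u ] t^ n [0] ≡ 0F ∷ u
  starts-with-0 zero    = [] , refl
  starts-with-0 (suc n) with t^ n [0] | starts-with-0 n
  ... | _ | u , refl = _ , refl

n<length-t^n[0] : ∀ n → n < length (t^ n [0])
n<length-t^n[0] zero    = s≤s z≤n
n<length-t^n[0] (suc n) with t^ n [0] | starts-with-0 n | n<length-t^n[0] n
... | _ | u , refl | s≤s n≤ =
  s≤s (s≤s (ℕ.m≤n⇒m≤o+n 3 (ℕ.≤-trans n≤ (length-t* u))))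

t^ω[0] : Infinite Letter
t^ω[0] n = lookup (t^ n [0]) (fromℕ< (n<length-t^n[0] n))

private
  extend-suc : ∀ n → ∃[ s ] t^ suc n [0] ≡ t^ n [0] ++ s
  extend-suc zero    = _ , refl
  extend-suc (suc n) with extend-suc n
  ... | s , eq = t* s , trans (cong t* eq) (concatMap-++ t (t^ n [0]) s)

  extend : ∀ k n → ∃[ s ] t^ k + n [0] ≡ t^ n [0] ++ s
  extend zero    n = [] , sym (++-identityʳ _)
  extend (suc k) n with extend k n | extend-suc (k + n)
  ... | s , eq | s′ , eq′ =
    s ++ s′ , trans eq′ (trans (cong (_++ s′) eq) (++-assoc (t^ n [0]) s s′))

  lookup-extend : ∀ (u s : List Letter) {v} → v ≡ u ++ s → ∀ i j → toℕ i ≡ toℕ j →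
                  lookup v i ≡ lookup u j
  lookup-extend (_ ∷ _) _ refl Fin.zero    Fin.zero    _  = refl
  lookup-extend (_ ∷ u) s refl (Fin.suc i) (Fin.suc j) eq =
    lookup-extend u s refl i j (ℕ.suc-injective eq)

  lookup-t^ : ∀ {m n} → m ≤ n → ∀ i j → toℕ i ≡ toℕ j →
              lookup (t^ n [0]) i ≡ lookup (t^ m [0]) j
  lookup-t^ {m} {n} m≤n with ℕ.m∸n+n≡m m≤n | extend (n ℕ.∸ m) m
  ... | eq | s , eq′ =
    lookup-extend (t^ m [0]) s (subst (λ k → t^ k [0] ≡ t^ m [0] ++ s) eq eq′)

-- t^ω[0] is the limit of the words t^ n [0].
t^n[0]-prefix : ∀ n → t^ n [0] IsPrefixOf t^ω[0]
t^n[0]-prefix n i with ℕ.≤-total n (toℕ i)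
... | inj₁ n≤i = sym (lookup-t^ n≤i _ i (toℕ-fromℕ< _))
... | inj₂ i≤n = lookup-t^ i≤n i _ (sym (toℕ-fromℕ< _))

permute : Permutation′ 3 → Infinite Letter → Infinite Letter
permute π x n = π ⟨$⟩ʳ x n

{-# OPTIONS --safe #-}

-- Deleting the letter 2 turns t into the square of the Thue–Morse morphism, so an overlap in t^ω(0)
-- would give one in the Thue–Morse word. Letters of t^ω(0) follow each other only as 00, 01, 11, 12
-- and 20, so a palindrome in it, being readable backwards, is a power of a single letter.
--
-- Conversely, a finite search over the factors of w of length at most 19 produces a permutation after
-- which the palindromes of w are those of t^ω(0). Having no aba, bbb and abba, the word w then keeps
-- one orientation of the cycle 0→1→2→0. Call a word good if it contains no t^n(s), for s in a short
-- list of words that turn the cycle the wrong way or are powers of exponent at least 9/4; the factors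
-- of w are good because t does not spoil these properties. A good word is, up to bounded margins, the
-- image under t of a word that is good again. Hence w is covered by words t^n(v) with v good and
-- |v| ≤ 3, and all such v are factors of t^ω(0); and it contains every t^n(0).
module Submission where

open import Defs
open import Data.Bool using (Bool; true; false; not; _xor_)
open import Data.Bool.Properties using (not-involutive; not-¬)
open import Data.Empty using (⊥)
open import Data.Fin using (toℕ; fromℕ<)
import Data.Fin as Fin
open import Data.Fin.Patterns using (0F; 1F; 2F)
open import Data.Fin.Permutation using (Permutation′; _⟨$⟩ʳ_; _⟨$⟩ˡ_; inverseˡ; inverseʳ; transpose; _∘ₚ_)
  renaming (id to idₚ)
import Data.Fin.Properties as Fin
open import Data.Fin.Properties using (toℕ-injective; toℕ<n; toℕ-fromℕ<)
open import Data.Integer using (+_)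
open import Data.Integer as ℤ using (ℤ)
import Data.Integer.Properties as ℤ
open import Data.List
  using (List; []; _∷_; _++_; [_]; length; lookup; map; applyUpTo; concatMap; reverse; _ʳ++_; take; drop; filter; deduplicate)
open import Data.List.NonEmpty as List⁺ using (List⁺; _∷_)
import Data.List.Membership.DecPropositional as DecMembership
import Data.List.Membership.Propositional as List
open import Data.List.Membership.Propositional.Properties using (∈-++⁻; ∈-map⁻)
open import Data.List.Properties
  using (++-assoc; ++-identityʳ; ++-ʳ++; ∷-injective; ≡-dec; applyUpTo-∷ʳ; concatMap-++; length-++; length-applyUpTo;
         length-map; length-reverse; length-ʳ++; lookup-applyUpTo; map-++; map-id-local; map-injective; map-∘;
         reverse-++; reverse-involutive; reverse-map; take++drop≡id; ʳ++-defn)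
open import Data.List.Relation.Binary.Infix.Heterogeneous as Infix using (Infix; View)
open import Data.List.Relation.Binary.Infix.Heterogeneous.Properties using (infix?)
open import Data.List.Relation.Binary.Pointwise using (Pointwise-≡⇒≡)
open import Data.List.Relation.Binary.Prefix.Heterogeneous as Prefix using (Prefix; PrefixView)
open import Data.List.Relation.Binary.Prefix.Heterogeneous.Properties using (prefix?)
open import Data.List.Relation.Unary.All as All using (All; []; _∷_; all?)
import Data.List.Relation.Unary.All.Properties as All
open import Data.List.Relation.Unary.AllPairs using (_∷_)
open import Data.List.Relation.Unary.Any as Any using (Any; here; there; any?)
open import Data.List.Relation.Unary.Linked using (Linked; []; [-]; _∷_)
open import Data.List.Relation.Unary.Unique.Propositional using (Unique)
import Data.List.Relation.Unary.Unique.DecPropositional as DecUnique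
import Data.List.Relation.Unary.Unique.DecPropositional.Properties as DecUnique
import Data.List.Relation.Unary.Unique.Propositional.Properties as Unique
open import Data.Nat
  using (ℕ; zero; suc; _+_; _*_; _^_; _≤_; _<_; s≤s; z≤n; NonZero; ⌊_/2⌋; ⌈_/2⌉; _≤?_; _<?_)
open import Data.Nat.DivMod using (_%_; m<n⇒m%n≡m; [m+n]%n≡m%n)
open import Data.Nat.GeneralisedArithmetic using (fold; fold-+)
open import Data.Nat.Induction using (Acc; acc; <-wellFounded)
import Data.Nat.Properties as ℕ
open import Data.Nat.Solver using (module +-*-Solver)
open import Data.Product using (_×_; ∃-syntax)
open import Data.Product using (∃₂; _,_; proj₁; proj₂)
open import Data.Rational using (_/_)
open import Data.Rational as ℚ using (1ℚ)
import Data.Rational.Properties as ℚ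
import Data.Rational.Unnormalised as ℚᵘ
import Data.Rational.Unnormalised.Properties as ℚᵘ
open import Data.Sum using (_⊎_; inj₁; inj₂)
open import Function using (_∘_; flip; mk⇔)
open import Level using (0ℓ)
open import Relation.Binary.Definitions using (DecidableEquality)
open import Relation.Binary.PropositionalEquality hiding ([_])
open import Relation.Nullary using (¬_; Dec; does; yes; no; contradiction)
open import Relation.Nullary.Decidable using (from-yes; map′; _×-dec_; _⊎-dec_)
open import Relation.Unary using (_≐_)
open import Relation.Unary using (Pred; Decidable)

-- Factors and windows

module _ {A : Set} where

  infix 4 _⊑_

  _⊑_ : List A → List A → Set
  u ⊑ w = ∃₂ λ p s → w ≡ p ++ u ++ s

  ⊑-refl : ∀ {u} → u ⊑ u
  ⊑-refl = [] , [] , sym (++-identityʳ _)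

  ⊑-++ˡ : ∀ p {u w} → u ⊑ w → u ⊑ p ++ w
  ⊑-++ˡ p (q , s , refl) = p ++ q , s , sym (++-assoc p q _)

  ⊑-++ʳ : ∀ {u w} s → u ⊑ w → u ⊑ w ++ s
  ⊑-++ʳ {u} s (p , q , refl) =
    p , q ++ s , trans (++-assoc p _ s) (cong (p ++_) (++-assoc u q s))

  ⊑-trans : ∀ {u v w} → u ⊑ v → v ⊑ w → u ⊑ w
  ⊑-trans u⊑v (p , s , refl) = ⊑-++ˡ p (⊑-++ʳ s u⊑v)

  ++-split : ∀ (p a : List A) {x y} → length p ≤ length a → a ++ x ≡ p ++ y →
             ∃[ r ] a ≡ p ++ r × r ++ x ≡ y
  ++-split []      a       _       eq = a , refl , eq
  ++-split (c ∷ p) (d ∷ a) (s≤s h) eq with ∷-injective eq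
  ... | refl , eq′ with ++-split p a h eq′
  ... | r , refl , eq″ = r , refl , eq″

  length-⊑ : ∀ {u w} → u ⊑ w → length u ≤ length w
  length-⊑ {u} (p , s , refl) = begin
    length u                        ≤⟨ ℕ.m≤m+n _ _ ⟩
    length u + length s             ≤⟨ ℕ.m≤n+m _ (length p) ⟩
    length p + (length u + length s) ≡⟨ cong (λ n → length p + n) (length-++ u) ⟨
    length p + length (u ++ s)      ≡⟨ length-++ p ⟨
    length (p ++ u ++ s)            ∎
    where open ℕ.≤-Reasoning

  -- This locates a padded factor after desubstitution: margins no longer than the padding cannot
  -- reach `u`, so `u` survives in the core `m`.
  ⊑-middle : ∀ a (u b p m q : List A) → a ++ u ++ b ≡ p ++ m ++ q →
             length p ≤ length a → length q ≤ length b → u ⊑ m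
  ⊑-middle a u b p m q eq p≤a q≤b with ++-split p a p≤a eq
  ... | r , refl , eq′ = r , proj₁ rest , trans (proj₁ (proj₂ rest)) (++-assoc r u _)
    where
    eq″ : m ++ q ≡ (r ++ u) ++ b
    eq″ = trans (sym eq′) (sym (++-assoc r u b))

    ru≤m : length (r ++ u) ≤ length m
    ru≤m = ℕ.+-cancelʳ-≤ (length q) _ _ (begin
      length (r ++ u) + length q  ≤⟨ ℕ.+-monoʳ-≤ (length (r ++ u)) q≤b ⟩
      length (r ++ u) + length b  ≡⟨ length-++ (r ++ u) ⟨
      length ((r ++ u) ++ b)      ≡⟨ cong length eq″ ⟨
      length (m ++ q)             ≡⟨ length-++ m ⟩
      length m + length q         ∎)
      where open ℕ.≤-Reasoning

    rest = ++-split (r ++ u) m ru≤m eq″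

  prefix-++⁻ˡ : ∀ (x : Infinite A) u {v} → (u ++ v) IsPrefixOf x → u IsPrefixOf x
  prefix-++⁻ˡ x (_ ∷ u) p Fin.zero    = p Fin.zero
  prefix-++⁻ˡ x (_ ∷ u) p (Fin.suc i) = prefix-++⁻ˡ (x ∘ suc) u (p ∘ Fin.suc) i

  prefix-++⁻ʳ : ∀ (x : Infinite A) u {v} → (u ++ v) IsPrefixOf x →
                v IsPrefixOf (λ k → x (length u + k))
  prefix-++⁻ʳ x []      p = p
  prefix-++⁻ʳ x (_ ∷ u) p = prefix-++⁻ʳ (x ∘ suc) u (p ∘ Fin.suc)

  prefix-++⁺ : ∀ (x : Infinite A) u {v} → u IsPrefixOf x →
               v IsPrefixOf (λ k → x (length u + k)) → (u ++ v) IsPrefixOf x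
  prefix-++⁺ x []      p q = q
  prefix-++⁺ x (_ ∷ u) p q Fin.zero    = p Fin.zero
  prefix-++⁺ x (_ ∷ u) p q (Fin.suc i) = prefix-++⁺ (x ∘ suc) u (p ∘ Fin.suc) q i

  prefix-cong : ∀ {x y : Infinite A} u → (∀ k → x k ≡ y k) → u IsPrefixOf x → u IsPrefixOf y
  prefix-cong u x≗y p i = trans (p i) (x≗y (toℕ i))

  prefix-map : ∀ {B : Set} (f : A → B) (x : Infinite A) u → u IsPrefixOf x →
               map f u IsPrefixOf (f ∘ x)
  prefix-map f x (_ ∷ u) p Fin.zero    = cong f (p Fin.zero)
  prefix-map f x (_ ∷ u) p (Fin.suc i) = prefix-map f (x ∘ suc) u (p ∘ Fin.suc) i

  prefix-total : ∀ (x : Infinite A) u v → u IsPrefixOf x → v IsPrefixOf x →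
                 length u ≤ length v → ∃[ r ] v ≡ u ++ r
  prefix-total x []      v       _ _ _ = v , refl
  prefix-total x (_ ∷ u) (_ ∷ v) p q (s≤s h)
    with trans (p Fin.zero) (sym (q Fin.zero))
       | prefix-total (x ∘ suc) u v (p ∘ Fin.suc) (q ∘ Fin.suc) h
  ... | refl | r , refl = r , refl

  surround : ∀ (x : Infinite A) n u m → u IsPrefixOf (λ k → x (n + k)) →
             ∃₂ λ l r → length l ≡ n × length r ≡ m × (l ++ u ++ r) IsPrefixOf x
  surround x n u m u-prefix =
    l , r , ∣l∣≡n , length-applyUpTo _ m ,
    prefix-++⁺ x l (lookup-applyUpTo x n)
      (subst (λ n → (u ++ r) IsPrefixOf (λ k → x (n + k))) (sym ∣l∣≡n)
        (prefix-++⁺ (λ k → x (n + k)) u u-prefix (lookup-applyUpTo _ m)))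
    where
    l = applyUpTo x n
    r = applyUpTo (λ k → x (n + (length u + k))) m
    ∣l∣≡n = length-applyUpTo x n

  Factors-⊑ : ∀ (x : Infinite A) {u v} → u ⊑ v → Factors x v → Factors x u
  Factors-⊑ x {u} (p , s , refl) (n , v-prefix) =
    n + length p ,
    prefix-cong u (λ k → cong x (sym (ℕ.+-assoc n (length p) k)))
      (prefix-++⁻ˡ (λ k → x (n + (length p + k))) u (prefix-++⁻ʳ (λ k → x (n + k)) p v-prefix))

  shift : BiInfinite A → ℤ → Infinite A
  shift w i k = w (i ℤ.+ + k)

  shift-+ : ∀ w i n k → shift w i (n + k) ≡ shift w (i ℤ.+ + n) k
  shift-+ w i n k = cong w (sym (ℤ.+-assoc i (+ n) (+ k)))

  Factorsℤ-⊑ : ∀ (w : BiInfinite A) {u v} → u ⊑ v → Factorsℤ w v → Factorsℤ w u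
  Factorsℤ-⊑ w {u} (p , s , refl) (i , v-prefix) =
    i ℤ.+ + length p ,
    prefix-cong u (shift-+ w i (length p)) (prefix-++⁻ˡ (λ k → shift w i (length p + k)) u (prefix-++⁻ʳ (shift w i) p v-prefix))

  Factorsℤ-extend : ∀ (w : BiInfinite A) {u} → Factorsℤ w u → ∀ n m →
                    ∃₂ λ l r → length l ≡ n × length r ≡ m × Factorsℤ w (l ++ u ++ r)
  Factorsℤ-extend w {u} (i , u-prefix) n m =
    let l , r , ∣l∣≡n , ∣r∣≡m , p = surround (shift w (i ℤ.- + n)) n u m u-prefix′
    in  l , r , ∣l∣≡n , ∣r∣≡m , i ℤ.- + n , p
    where
    i-n+n≡i : i ℤ.- + n ℤ.+ + n ≡ i
    i-n+n≡i = trans (ℤ.+-assoc i _ (+ n))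
                (trans (cong (λ n → i ℤ.+ n) (ℤ.+-inverseˡ (+ n))) (ℤ.+-identityʳ i))

    u-prefix′ : u IsPrefixOf (λ k → shift w (i ℤ.- + n) (n + k))
    u-prefix′ = prefix-cong u
      (λ k → sym (trans (shift-+ w (i ℤ.- + n) n k) (cong (λ j → shift w j k) i-n+n≡i)))
      u-prefix

  private
    ordered : ∀ (w : BiInfinite A) {i j} u v → i ℤ.≤ j →
              u IsPrefixOf shift w i → v IsPrefixOf shift w j →
              ∃[ z ] Factorsℤ w z × u ⊑ z × v ⊑ z
    ordered w {i} {j} u v i≤j p q
      -- The `length u` further letters to the right of `v` make the window long enough to begin
      -- with all of `u`, even where `u` ends after `v`.
      with surround (shift w i) d v (length u) (prefix-cong v at-j q)
      where
      d = ℤ.∣ j ℤ.- i ∣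
      i+d≡j : i ℤ.+ + d ≡ j
      i+d≡j = trans (cong (λ n → i ℤ.+ n) (ℤ.0≤i⇒+∣i∣≡i (ℤ.i≤j⇒0≤j-i i≤j)))
        (trans (ℤ.+-comm i (j ℤ.- i)) (trans (ℤ.+-assoc j _ i)
          (trans (cong (λ n → j ℤ.+ n) (ℤ.+-inverseˡ i)) (ℤ.+-identityʳ j))))
      at-j : ∀ k → shift w j k ≡ shift w i (d + k)
      at-j k = sym (trans (shift-+ w i d k) (cong (λ j → shift w j k) i+d≡j))
    ... | l , r , _ , ∣r∣≡∣u∣ , z-prefix =
      z , (i , z-prefix) , ([] , prefix-total (shift w i) u z p z-prefix u≤z) , (l , r , refl)
      where
      z = l ++ v ++ r
      u≤z : length u ≤ length z
      u≤z = begin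
        length u         ≡⟨ ∣r∣≡∣u∣ ⟨
        length r         ≤⟨ length-⊑ (l ++ v , [] , eq) ⟩
        length z         ∎
        where
        open ℕ.≤-Reasoning
        eq : z ≡ (l ++ v) ++ r ++ []
        eq = trans (sym (++-assoc l v r)) (cong ((l ++ v) ++_) (sym (++-identityʳ r)))

  -- The window starts where the earlier of the two occurrences does. Later this lets one occurrence
  -- of 01 fix the orientation of every other factor.
  Factorsℤ-directed : ∀ (w : BiInfinite A) {u v} → Factorsℤ w u → Factorsℤ w v →
                      ∃[ z ] Factorsℤ w z × u ⊑ z × v ⊑ z
  Factorsℤ-directed w {u} {v} (i , p) (j , q) with ℤ.≤-total i j
  ... | inj₁ i≤j = ordered w u v i≤j p q
  ... | inj₂ j≤i = let z , Fz , v⊑z , u⊑z = ordered w v u j≤i q p in z , Fz , u⊑z , v⊑z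

⊑-map : ∀ {A B : Set} (f : A → B) {u w} → u ⊑ w → map f u ⊑ map f w
⊑-map f {u} (p , s , refl) =
  map f p , map f s , trans (map-++ f p _) (cong (map f p ++_) (map-++ f u s))

Factors-map : ∀ {A B : Set} (f : A → B) (x : Infinite A) u →
              Factors x u → Factors (f ∘ x) (map f u)
Factors-map f x u (n , p) = n , prefix-map f (λ k → x (n + k)) u p

Factorsℤ-map : ∀ {A B : Set} (f : A → B) (w : BiInfinite A) u →
               Factorsℤ w u → Factorsℤ (f ∘ w) (map f u)
Factorsℤ-map f w u (i , p) = i , prefix-map f (shift w i) u p

-- Powers and their exponents

module _ {A : Set} where

  -- Splitting the period as `y ++ z` turns "exponent at least 9/4" into
  -- `length (y ++ z) ≤ 4 * length y`, and lets a morphism act on `y` and `z` separately.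
  square-plus : List A × List A → List A
  square-plus (y , z) = (y ++ z) ++ (y ++ z) ++ y

  periodic-self : ∀ (u : List⁺ A) → List⁺.toList u IsPrefixOf periodic u
  periodic-self u i = cong (lookup (List⁺.toList u)) (sym (toℕ-injective
    (trans (toℕ-fromℕ< _) (m<n⇒m%n≡m (toℕ<n i)))))

  periodic-shift : ∀ (u : List⁺ A) k → periodic u (List⁺.length u + k) ≡ periodic u k
  periodic-shift u k = cong (lookup (List⁺.toList u)) (toℕ-injective
    (trans (toℕ-fromℕ< _) (trans (trans (cong (_% p) (ℕ.+-comm p k)) ([m+n]%n≡m%n k p)) (sym (toℕ-fromℕ< _)))))
    where p = List⁺.length u

  periodic-++ : ∀ (u : List⁺ A) v → v IsPrefixOf periodic u →
                (List⁺.toList u ++ v) IsPrefixOf periodic u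
  periodic-++ u v p = prefix-++⁺ (periodic u) (List⁺.toList u) (periodic-self u)
    (prefix-cong v (λ k → sym (periodic-shift u k)) p)

≤⇒/≥9/4 : ∀ a b .{{_ : NonZero b}} → 9 * b ≤ 4 * a → (+ a) / b ℚ.≥ (+ 9) / 4
≤⇒/≥9/4 a (suc b) 9b≤4a = ℚ.toℚᵘ-cancel-≤ (ℚᵘ.≤-respʳ-≃
  (ℚᵘ.≃-sym (ℚ.toℚᵘ-fromℚᵘ (ℚᵘ.mkℚᵘ (+ a) b)))
  (ℚᵘ.*≤* (subst₂ ℤ._≤_ (ℤ.pos-* 9 (suc b)) (trans (cong +_ (ℕ.*-comm 4 a)) (ℤ.pos-* a 4)) (ℤ.+≤+ 9b≤4a))))

/>2⇒< : ∀ a b .{{_ : NonZero b}} → (+ a) / b ℚ.> (+ 2) / 1 → 2 * b < a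
/>2⇒< a (suc b) a/b>2 with ℚᵘ.<-respʳ-≃ (ℚ.toℚᵘ-fromℚᵘ (ℚᵘ.mkℚᵘ (+ a) b)) (ℚ.toℚᵘ-mono-< a/b>2)
... | ℚᵘ.*<* lt = subst (2 * suc b <_) (ℕ.*-identityʳ a)
  (ℤ.drop‿+<+ (subst₂ ℤ._<_ (sym (ℤ.pos-* 2 (suc b))) (sym (ℤ.pos-* a 1)) lt))

Free-square-plus : ∀ {A : Set} {L : Pred (List A) 0ℓ} → Free ((+ 9) / 4) L → ∀ y z →
                   0 < length y → length (y ++ z) ≤ 4 * length y → ¬ L (square-plus (y , z))
Free-square-plus free (a ∷ y) z _ h v∈L = free u v r v∈L (ℚ.<-≤-trans 1<9/4 r≥9/4 , prefix , refl) r≥9/4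
  where
  u = a ∷ (y ++ z)
  x = List⁺.toList u
  v = x ++ x ++ (a ∷ y)
  p = length x
  r = (+ length v) / p
  1<9/4 : 1ℚ ℚ.< (+ 9) / 4
  1<9/4 = from-yes (1ℚ ℚ.<? (+ 9) / 4)
  prefix : v IsPrefixOf periodic u
  prefix = periodic-++ u _ (periodic-++ u (a ∷ y) (prefix-++⁻ˡ (periodic u) (a ∷ y) (periodic-self u)))
  r≥9/4 : r ℚ.≥ (+ 9) / 4
  r≥9/4 = ≤⇒/≥9/4 (length v) p (begin
    9 * p                              ≡⟨ ℕ.*-distribʳ-+ p 1 8 ⟩
    1 * p + 8 * p                      ≡⟨ cong (_+ 8 * p) (ℕ.*-identityˡ p) ⟩
    p + 8 * p                          ≤⟨ ℕ.+-monoˡ-≤ (8 * p) h ⟩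
    4 * length (a ∷ y) + 8 * p         ≡⟨ solve 2 (λ y p → con 4 :* y :+ con 8 :* p := con 4 :* (p :+ (p :+ y))) refl (length (a ∷ y)) p ⟩
    4 * (p + (p + length (a ∷ y)))     ≡⟨ cong (λ n → 4 * (p + n)) (length-++ x) ⟨
    4 * (p + length (x ++ a ∷ y))      ≡⟨ cong (4 *_) (length-++ x) ⟨
    4 * length v                       ∎)
    where
    open ℕ.≤-Reasoning
    open +-*-Solver

-- Iterates of `t` and adjacent letters

tⁿ : ℕ → List Letter → List Letter
tⁿ n u = fold u t* n

tⁿ-++ : ∀ n u v → tⁿ n (u ++ v) ≡ tⁿ n u ++ tⁿ n v
tⁿ-++ zero    u v = refl
tⁿ-++ (suc n) u v = trans (cong t* (tⁿ-++ n u v)) (concatMap-++ t (tⁿ n u) _)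

tⁿ-⊑ : ∀ n {u v} → u ⊑ v → tⁿ n u ⊑ tⁿ n v
tⁿ-⊑ n {u} (p , s , refl) =
  tⁿ n p , tⁿ n s , trans (tⁿ-++ n p _) (cong (tⁿ n p ++_) (tⁿ-++ n u s))

Factors⇒⊑ : ∀ {u} → Factors t^ω[0] u → ∃[ n ] u ⊑ tⁿ n [ 0F ]
Factors⇒⊑ {u} (n , p) = N , ⊑-trans (l , r , refl) ([] , prefix-total t^ω[0] z _ z-prefix (t^n[0]-prefix N) (ℕ.<⇒≤ (n<length-t^n[0] N)))
  where
  window = surround t^ω[0] n u 0 p
  l = proj₁ window
  r = proj₁ (proj₂ window)
  z = l ++ u ++ r
  z-prefix = proj₂ (proj₂ (proj₂ (proj₂ window)))
  -- The word `tⁿ N [ 0F ]` has more than `N` letters, so as a prefix of `t^ω[0]` it covers the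
  -- whole window `z`.
  N = length z

⊑⇒Factors : ∀ n {u} → u ⊑ tⁿ n [ 0F ] → Factors t^ω[0] u
⊑⇒Factors n u⊑ = Factors-⊑ t^ω[0] u⊑ (0 , t^n[0]-prefix n)

data _⇝_ : Letter → Letter → Set where
  0⇝0 : 0F ⇝ 0F
  0⇝1 : 0F ⇝ 1F
  1⇝1 : 1F ⇝ 1F
  1⇝2 : 1F ⇝ 2F
  2⇝0 : 2F ⇝ 0F

Linked-⊑ : ∀ {A : Set} {R : A → A → Set} {a b w} → Linked R w → (a ∷ b ∷ []) ⊑ w → R a b
Linked-⊑ (r ∷ _)  ([]        , _ , refl) = r
Linked-⊑ (_ ∷ rs) (_ ∷ p     , s , eq)   = Linked-⊑ rs (p , s , proj₂ (∷-injective eq))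
Linked-⊑ [-]      (_ ∷ []    , _ , ())
Linked-⊑ [-]      (_ ∷ _ ∷ _ , _ , ())

-- Each block `t a` begins and ends with `a`, so the step across the border of two blocks is the
-- step between the original letters.
t*-⇝ : ∀ {u} → Linked _⇝_ u → Linked _⇝_ (t* u)
t*-⇝ []          = []
t*-⇝ ([-] {0F})  = 0⇝1 ∷ 1⇝1 ∷ 1⇝2 ∷ 2⇝0 ∷ [-]
t*-⇝ ([-] {1F})  = 1⇝2 ∷ 2⇝0 ∷ 0⇝0 ∷ 0⇝1 ∷ [-]
t*-⇝ ([-] {2F})  = [-]
t*-⇝ (0⇝0 ∷ u)   = 0⇝1 ∷ 1⇝1 ∷ 1⇝2 ∷ 2⇝0 ∷ 0⇝0 ∷ t*-⇝ u
t*-⇝ (0⇝1 ∷ u)   = 0⇝1 ∷ 1⇝1 ∷ 1⇝2 ∷ 2⇝0 ∷ 0⇝1 ∷ t*-⇝ u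
t*-⇝ (1⇝1 ∷ u)   = 1⇝2 ∷ 2⇝0 ∷ 0⇝0 ∷ 0⇝1 ∷ 1⇝1 ∷ t*-⇝ u
t*-⇝ (1⇝2 ∷ u)   = 1⇝2 ∷ 2⇝0 ∷ 0⇝0 ∷ 0⇝1 ∷ 1⇝2 ∷ t*-⇝ u
t*-⇝ (2⇝0 ∷ u)   = 2⇝0 ∷ t*-⇝ u

tⁿ[0]-⇝ : ∀ n → Linked _⇝_ (tⁿ n [ 0F ])
tⁿ[0]-⇝ zero    = [-]
tⁿ[0]-⇝ (suc n) = t*-⇝ (tⁿ[0]-⇝ n)

-- The Thue–Morse word

odd : ℕ → Bool
odd zero    = false
odd (suc n) = not (odd n)

odd-double : ∀ n → odd (n + n) ≡ false
odd-double zero    = refl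
odd-double (suc n) rewrite ℕ.+-suc n n | odd-double n = refl

private
  -- This is the parity of the binary digit sum; the first argument is fuel bounding the number of
  -- halvings.
  digit-sum : ℕ → ℕ → Bool
  digit-sum zero       n = false
  digit-sum (suc fuel) n = odd n xor digit-sum fuel ⌊ n /2⌋

  ⌊n/2⌋≤ : ∀ {m} n → n ≤ suc m → ⌊ n /2⌋ ≤ m
  ⌊n/2⌋≤ zero    _       = z≤n
  ⌊n/2⌋≤ (suc n) (s≤s h) = ℕ.≤-trans (ℕ.≤-pred (ℕ.⌊n/2⌋<n n)) h

  digit-sum-0 : ∀ f → digit-sum f 0 ≡ false
  digit-sum-0 zero    = refl
  digit-sum-0 (suc f) = digit-sum-0 f

  digit-sum-fuel : ∀ f g n → n ≤ f → n ≤ g → digit-sum f n ≡ digit-sum g n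
  digit-sum-fuel zero    g       .zero z≤n _   = sym (digit-sum-0 g)
  digit-sum-fuel (suc f) zero    .zero _   z≤n = digit-sum-0 (suc f)
  digit-sum-fuel (suc f) (suc g) n     n≤f n≤g =
    cong (odd n xor_) (digit-sum-fuel f g ⌊ n /2⌋ (⌊n/2⌋≤ n n≤f) (⌊n/2⌋≤ n n≤g))

τ : Infinite Bool
τ n = digit-sum n n

private
  τ-unfold : ∀ n → τ n ≡ odd n xor τ ⌊ n /2⌋
  τ-unfold zero    = refl
  τ-unfold (suc n) = cong (odd (suc n) xor_)
    (digit-sum-fuel n ⌊ suc n /2⌋ ⌊ suc n /2⌋ (⌊n/2⌋≤ (suc n) ℕ.≤-refl) ℕ.≤-refl)

τ-even : ∀ n → τ (n + n) ≡ τ n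
τ-even n = trans (τ-unfold (n + n))
  (cong₂ (λ b m → b xor τ m) (odd-double n) (sym (ℕ.n≡⌊n+n/2⌋ n)))

τ-odd : ∀ n → τ (suc (n + n)) ≡ not (τ n)
τ-odd n = trans (τ-unfold (suc (n + n)))
  (cong₂ (λ b m → not b xor τ m) (odd-double n) (sym (ℕ.n≡⌈n+n/2⌉ n)))

halve : ∀ n → ∃[ m ] (n ≡ m + m ⊎ n ≡ suc (m + m))
halve zero    = 0 , inj₁ refl
halve (suc n) with halve n
... | m , inj₁ refl = m , inj₂ refl
... | m , inj₂ refl = suc m , inj₁ (cong suc (sym (ℕ.+-suc m m)))

-- Positions up to and including `p` are compared, so the window has length 2p + 1: a square and one
-- more letter.
Overlap : ∀ {A : Set} → Infinite A → ℕ → Set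
Overlap x p = ∀ k → k ≤ p → x k ≡ x (p + k)

private
  τ-pair : ∀ m → τ (suc (m + m)) ≡ not (τ (m + m))
  τ-pair m = trans (τ-odd m) (cong not (sym (τ-even m)))

  -- An odd period carries the pairs τ (2m) ≢ τ (2m+1) to the pairs at odd positions, so the word alternates.
  odd-period⇒alternating : ∀ j r → let p = suc (r + r) in Overlap (λ k → τ (j + k)) p →
                           ∀ k → k < p → τ (j + suc k) ≡ not (τ (j + k))
  odd-period⇒alternating j r agree k k<p with halve (j + k)
  ... | m , inj₁ j+k≡2m rewrite ℕ.+-suc j k | j+k≡2m = τ-pair m
  ... | m , inj₂ j+k≡1+2m = begin
    τ (j + suc k)             ≡⟨ agree (suc k) k<p ⟩
    τ (j + (p + suc k))       ≡⟨ cong τ (solve 3 (λ j p k → j :+ (p :+ (con 1 :+ k)) := con 1 :+ (p :+ (j :+ k))) refl j p k) ⟩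
    τ (suc (p + (j + k)))     ≡⟨ cong (λ n → τ (suc n)) p+j+k≡2e ⟩
    τ (suc (e + e))           ≡⟨ τ-pair e ⟩
    not (τ (e + e))           ≡⟨ cong (not ∘ τ) p+j+k≡2e ⟨
    not (τ (p + (j + k)))     ≡⟨ cong (not ∘ τ) (solve 3 (λ j p k → p :+ (j :+ k) := j :+ (p :+ k)) refl j p k) ⟩
    not (τ (j + (p + k)))     ≡⟨ cong not (agree k (ℕ.<⇒≤ k<p)) ⟨
    not (τ (j + k))           ∎
    where
    open ≡-Reasoning
    open +-*-Solver
    p = suc (r + r)
    e = suc (r + m)
    p+j+k≡2e : p + (j + k) ≡ e + e
    p+j+k≡2e = trans (cong (λ n → p + n) j+k≡1+2m)
      (solve 2 (λ r m → con 1 :+ (r :+ r) :+ (con 1 :+ (m :+ m)) := con 1 :+ (r :+ m) :+ (con 1 :+ (r :+ m))) refl r m)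

  alternating⇒2-periodic : ∀ (x : Infinite Bool) n → (∀ k → k < n + n → x (suc k) ≡ not (x k)) →
                           x (n + n) ≡ x 0
  alternating⇒2-periodic x zero    _   = refl
  alternating⇒2-periodic x (suc n) alt rewrite ℕ.+-suc n n = begin
    x (suc (suc (n + n)))  ≡⟨ alt (suc (n + n)) ℕ.≤-refl ⟩
    not (x (suc (n + n)))  ≡⟨ cong not (alt (n + n) (ℕ.m≤n⇒m≤1+n ℕ.≤-refl)) ⟩
    not (not (x (n + n)))  ≡⟨ not-involutive _ ⟩
    x (n + n)              ≡⟨ alternating⇒2-periodic x n (λ k k< → alt k (ℕ.m≤n⇒m≤1+n (ℕ.m≤n⇒m≤1+n k<))) ⟩
    x 0                    ∎
    where open ≡-Reasoning

-- Descent on the period. An odd period forces alternation, and then the letters at distance `p`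
-- differ. An even period is halved: every second letter from `j` on spells `τ` or its complement
-- from `i` on.
τ-overlap-free : ∀ p j → 0 < p → ¬ Overlap (λ k → τ (j + k)) p
τ-overlap-free p j 0<p = go (<-wellFounded p) j 0<p
  where
  go : ∀ {p} → Acc _<_ p → ∀ j → 0 < p → ¬ Overlap (λ k → τ (j + k)) p
  go {p} (acc rec) j 0<p agree with halve p
  ... | r , inj₂ refl = not-¬ refl (begin
    τ (j + 0)                  ≡⟨ agree 0 z≤n ⟩
    τ (j + (p′ + 0))           ≡⟨ cong (λ n → τ (j + n)) (ℕ.+-identityʳ p′) ⟩
    τ (j + p′)                 ≡⟨ alternating (r + r) ℕ.≤-refl ⟩
    not (τ (j + (r + r)))      ≡⟨ cong not (alternating⇒2-periodic (λ k → τ (j + k)) r (λ k k< → alternating k (ℕ.m≤n⇒m≤1+n k<))) ⟩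
    not (τ (j + 0))            ∎)
    where
    open ≡-Reasoning
    p′ = suc (r + r)
    alternating = odd-period⇒alternating j r agree
  ... | zero , inj₁ refl = contradiction 0<p λ ()
  ... | suc r′ , inj₁ refl with halve j
  ... | i , j≡ = go (rec (ℕ.m<m+n r (s≤s z≤n))) i (s≤s z≤n) (half j≡)
    where
    r = suc r′
    open ≡-Reasoning
    open +-*-Solver
    half : (j ≡ i + i ⊎ j ≡ suc (i + i)) → Overlap (λ k → τ (i + k)) r
    half (inj₁ refl) k k≤r = begin
      τ (i + k)                        ≡⟨ τ-even (i + k) ⟨
      τ (i + k + (i + k))              ≡⟨ cong τ (solve 2 (λ i k → i :+ k :+ (i :+ k) := i :+ i :+ (k :+ k)) refl i k) ⟩
      τ (i + i + (k + k))              ≡⟨ agree (k + k) (ℕ.+-mono-≤ k≤r k≤r) ⟩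
      τ (i + i + (r + r + (k + k)))    ≡⟨ cong τ (solve 3 (λ i r k → i :+ i :+ (r :+ r :+ (k :+ k)) := (i :+ (r :+ k)) :+ (i :+ (r :+ k))) refl i r k) ⟩
      τ (i + (r + k) + (i + (r + k)))  ≡⟨ τ-even (i + (r + k)) ⟩
      τ (i + (r + k))                  ∎
    half (inj₂ refl) k k≤r = trans (sym (not-involutive _)) (trans (cong not (begin
      not (τ (i + k))                        ≡⟨ τ-odd (i + k) ⟨
      τ (suc (i + k + (i + k)))              ≡⟨ cong τ (solve 2 (λ i k → con 1 :+ (i :+ k :+ (i :+ k)) := con 1 :+ (i :+ i) :+ (k :+ k)) refl i k) ⟩
      τ (suc (i + i) + (k + k))              ≡⟨ agree (k + k) (ℕ.+-mono-≤ k≤r k≤r) ⟩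
      τ (suc (i + i) + (r + r + (k + k)))    ≡⟨ cong τ (solve 3 (λ i r k → con 1 :+ (i :+ i) :+ (r :+ r :+ (k :+ k)) := con 1 :+ ((i :+ (r :+ k)) :+ (i :+ (r :+ k)))) refl i r k) ⟩
      τ (suc (i + (r + k) + (i + (r + k))))  ≡⟨ τ-odd (i + (r + k)) ⟩
      not (τ (i + (r + k)))                  ∎)) (not-involutive _))

-- Equalities of positions suit arithmetic on indices, while the explicit word can be erased and
-- traced through factors; this lemma and the next translate between the two.
overlap-factor : ∀ {A : Set} (x : Infinite A) p → 0 < p → Overlap x p →
                 ∃[ u ] let v = x 0 ∷ u in (v ++ v ++ [ x 0 ]) IsPrefixOf x
overlap-factor x (suc n) _ agree =
  u , subst (λ z → (v ++ z) IsPrefixOf x) z≡v++x0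
    (prefix-++⁺ x v (lookup-applyUpTo x p) (subst (λ m → z IsPrefixOf (λ k → x (m + k)))
      (sym (length-applyUpTo x p)) z-prefix))
  where
  p = suc n
  u = applyUpTo (x ∘ suc) n
  v = x 0 ∷ u
  z = applyUpTo x (suc p)
  z≡v++x0 : z ≡ v ++ [ x 0 ]
  z≡v++x0 = trans (sym (applyUpTo-∷ʳ x p))
    (cong (λ c → v ++ [ c ]) (trans (cong x (sym (ℕ.+-identityʳ p))) (sym (agree 0 z≤n))))
  z-prefix : z IsPrefixOf (λ k → x (p + k))
  z-prefix i = trans (lookup-applyUpTo x (suc p) i)
    (agree (toℕ i) (ℕ.≤-pred (subst (toℕ i <_) (length-applyUpTo x (suc p)) (toℕ<n i))))

factor-overlap : ∀ {A : Set} (x : Infinite A) a u → let v = a ∷ u in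
                 (v ++ v ++ [ a ]) IsPrefixOf x → Overlap x (length v)
factor-overlap x a u prefix k k≤p =
  trans (sym (at x z-prefix)) (at (λ k → x (length v + k)) (prefix-++⁻ʳ x v prefix))
  where
  v = a ∷ u
  z = v ++ [ a ]
  k<∣z∣ : k < length z
  k<∣z∣ = subst (k <_) (sym (trans (length-++ v) (ℕ.+-comm (length v) 1))) (s≤s k≤p)
  z-prefix : z IsPrefixOf x
  z-prefix = prefix-++⁻ˡ x z (subst (_IsPrefixOf x)
    (trans (cong (v ++_) (sym (++-assoc [ a ] u [ a ]))) (sym (++-assoc v [ a ] (u ++ [ a ])))) prefix)
  at : ∀ (y : Infinite _) → z IsPrefixOf y → lookup z (fromℕ< k<∣z∣) ≡ y k
  at y p = trans (p (fromℕ< k<∣z∣)) (cong y (toℕ-fromℕ< k<∣z∣))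

-- Overlap-freeness of `t^ω[0]`

erase₂ : Letter → List Bool
erase₂ 0F = [ false ]
erase₂ 1F = [ true ]
erase₂ 2F = []

erase₂* : List Letter → List Bool
erase₂* = concatMap erase₂

μ : Bool → List Bool
μ b = b ∷ not b ∷ []

μ* : List Bool → List Bool
μ* = concatMap μ

erase₂*-t* : ∀ u → erase₂* (t* u) ≡ μ* (μ* (erase₂* u))
erase₂*-t* []       = refl
erase₂*-t* (0F ∷ u) = cong (λ v → false ∷ true ∷ true ∷ false ∷ v) (erase₂*-t* u)
erase₂*-t* (1F ∷ u) = cong (λ v → true ∷ false ∷ false ∷ true ∷ v) (erase₂*-t* u)
erase₂*-t* (2F ∷ u) = erase₂*-t* u

μ*-applyUpTo : ∀ n (x y : Infinite Bool) → (∀ k → y (k + k) ≡ x k) → (∀ k → y (suc (k + k)) ≡ not (x k)) →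
               μ* (applyUpTo x n) ≡ applyUpTo y (n + n)
μ*-applyUpTo zero    x y even odd = refl
μ*-applyUpTo (suc n) x y even odd rewrite ℕ.+-suc n n =
  cong₂ _∷_ (sym (even 0)) (cong₂ _∷_ (sym (odd 0)) (μ*-applyUpTo n (x ∘ suc) (y ∘ suc ∘ suc)
    (λ k → trans (cong (y ∘ suc) (sym (ℕ.+-suc k k))) (even (suc k)))
    (λ k → trans (cong (y ∘ suc ∘ suc) (sym (ℕ.+-suc k k))) (odd (suc k)))))

erase₂*-tⁿ[0] : ∀ n → ∃[ m ] erase₂* (tⁿ n [ 0F ]) ≡ applyUpTo τ m
erase₂*-tⁿ[0] zero    = 1 , refl
erase₂*-tⁿ[0] (suc n) with erase₂*-tⁿ[0] n
... | m , eq = m + m + (m + m) , (begin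
  erase₂* (t* (tⁿ n [ 0F ]))    ≡⟨ erase₂*-t* (tⁿ n [ 0F ]) ⟩
  μ* (μ* (erase₂* (tⁿ n [ 0F ]))) ≡⟨ cong (μ* ∘ μ*) eq ⟩
  μ* (μ* (applyUpTo τ m))         ≡⟨ cong μ* (μ*-applyUpTo m τ τ τ-even τ-odd) ⟩
  μ* (applyUpTo τ (m + m))        ≡⟨ μ*-applyUpTo (m + m) τ τ τ-even τ-odd ⟩
  applyUpTo τ (m + m + (m + m))   ∎)
  where open ≡-Reasoning

⊑-concatMap : ∀ {A B : Set} (f : A → List B) {u w} → u ⊑ w → concatMap f u ⊑ concatMap f w
⊑-concatMap f {u} (p , s , refl) = concatMap f p , concatMap f s ,
  trans (concatMap-++ f p _) (cong (concatMap f p ++_) (concatMap-++ f u s))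

t^ω-⇝ : ∀ n → t^ω[0] n ⇝ t^ω[0] (suc n)
t^ω-⇝ n with Factors⇒⊑ {t^ω[0] n ∷ t^ω[0] (suc n) ∷ []} (n , λ
             { Fin.zero            → cong t^ω[0] (sym (ℕ.+-identityʳ n))
             ; (Fin.suc Fin.zero)  → cong t^ω[0] (sym (ℕ.+-comm n 1)) })
... | N , occ = Linked-⊑ (tⁿ[0]-⇝ N) occ

2⇝⇒0 : ∀ {a b} → a ≡ 2F → a ⇝ b → b ≡ 0F
2⇝⇒0 refl 2⇝0 = refl

private
  -- The repeated first letter must survive the erasure of 2 for the erased word to be an overlap
  -- again, with a nonzero period; hence the condition on the letter at `j`.
  no-overlap : ∀ j p → 0 < p → t^ω[0] (j + 0) ≢ 2F → ¬ Overlap (λ k → t^ω[0] (j + k)) p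
  no-overlap j p 0<p ≢2 agree
    with overlap-factor (λ k → t^ω[0] (j + k)) p 0<p agree
  ... | u , prefix with Factors⇒⊑ (j , prefix)
  ... | N , occ = erased (t^ω[0] (j + 0)) u ≢2 occ
    where
    erased-overlap : ∀ c a u → erase₂ a ≡ [ c ] → (let v = a ∷ u in (v ++ v ++ [ a ]) ⊑ tⁿ N [ 0F ]) →
                     ⊥
    erased-overlap c a u a↦c occ = τ-overlap-free _ i (s≤s z≤n) (factor-overlap _ c (erase₂* u) prefix′)
      where
      v = a ∷ u
      eq : erase₂* (v ++ v ++ [ a ]) ≡ (c ∷ erase₂* u) ++ (c ∷ erase₂* u) ++ [ c ]
      eq = trans (concatMap-++ erase₂ v _) (trans (cong (erase₂* v ++_) (concatMap-++ erase₂ v [ a ]))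
             (cong₂ (λ x y → x ++ x ++ y) (cong (_++ erase₂* u) a↦c) (trans (++-identityʳ _) a↦c)))
      factor : Factors τ ((c ∷ erase₂* u) ++ (c ∷ erase₂* u) ++ [ c ])
      factor = Factors-⊑ τ (subst₂ _⊑_ eq (proj₂ (erase₂*-tⁿ[0] N)) (⊑-concatMap erase₂ occ))
                 (0 , lookup-applyUpTo τ (proj₁ (erase₂*-tⁿ[0] N)))
      i = proj₁ factor
      prefix′ = proj₂ factor

    erased : ∀ a u → a ≢ 2F → (let v = a ∷ u in (v ++ v ++ [ a ]) ⊑ tⁿ N [ 0F ]) → ⊥
    erased 0F u _  = erased-overlap false 0F u refl
    erased 1F u _  = erased-overlap true 1F u refl
    erased 2F u ≢2 = contradiction refl ≢2

t^ω-overlap-free : ∀ j p → 0 < p → ¬ Overlap (λ k → t^ω[0] (j + k)) p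
t^ω-overlap-free j p@(suc n) 0<p agree with t^ω[0] (j + 0) Fin.≟ 2F
... | no  ≢2 = no-overlap j p 0<p ≢2 agree
-- A letter 2 is followed by 0, so an overlap starting with 2 can be shifted by one.
... | yes ≡2 = no-overlap (suc j) p 0<p (λ eq → 0≢2 (trans (sym (after ≡2)) (trans (cong t^ω[0] (ℕ.+-suc j 0)) eq))) shifted
  where
  x : Infinite Letter
  x k = t^ω[0] (j + k)
  0≢2 : Fin.zero ≢ Fin.suc (Fin.suc (Fin.zero {0}))
  0≢2 ()
  after : ∀ {k} → x k ≡ 2F → x (suc k) ≡ 0F
  after {k} ≡2 = trans (cong t^ω[0] (ℕ.+-suc j k)) (2⇝⇒0 ≡2 (t^ω-⇝ (j + k)))
  xp≡2 : x p ≡ 2F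
  xp≡2 = trans (cong x (sym (ℕ.+-identityʳ p))) (trans (sym (agree 0 z≤n)) ≡2)
  agree′ : ∀ k → k ≤ p → x (suc k) ≡ x (suc (p + k))
  agree′ k k≤p with ℕ.m≤n⇒m<n∨m≡n k≤p
  ... | inj₁ k<p  = trans (agree (suc k) k<p) (cong x (ℕ.+-suc p k))
  -- Here the given equalities run out, but both letters follow a 2, so both are 0.
  ... | inj₂ refl = trans (after xp≡2) (sym (after (trans (sym (agree p ℕ.≤-refl)) xp≡2)))
  shifted : Overlap (λ k → t^ω[0] (suc j + k)) p
  shifted k k≤p = trans (cong t^ω[0] (sym (ℕ.+-suc j k)))
    (trans (agree′ k k≤p) (cong t^ω[0] (ℕ.+-suc j (p + k))))

-- A power of exponent above 2 has at least 2|u| + 1 letters and so begins with an overlap of period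
-- |u|.
t^ω-Free⁺ : Free⁺ ((+ 2) / 1) (Factors t^ω[0])
t^ω-Free⁺ u@(a ∷ u′) v r (j , v-prefix) (_ , v-periodic , refl) r>2 =
  t^ω-overlap-free j (length w) (s≤s z≤n) (factor-overlap _ a u′ (prefix-++⁻ˡ (λ k → t^ω[0] (j + k)) (w ++ w ++ [ a ])
    (subst (_IsPrefixOf (λ k → t^ω[0] (j + k))) v≡ v-prefix)))
  where
  w = a ∷ u′
  z-periodic : (w ++ w ++ [ a ]) IsPrefixOf periodic u
  z-periodic = periodic-++ u _ (periodic-++ u _ (prefix-++⁻ˡ (periodic u) [ a ] (periodic-self u)))
  ∣z∣≤∣v∣ : length (w ++ w ++ [ a ]) ≤ length v
  ∣z∣≤∣v∣ = begin
    length (w ++ w ++ [ a ])                ≡⟨ length-++ w ⟩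
    length w + length (w ++ [ a ])          ≡⟨ cong (λ n → length w + n) (length-++ w) ⟩
    length w + (length w + 1)               ≡⟨ solve 1 (λ n → n :+ (n :+ con 1) := con 1 :+ con 2 :* n) refl (length w) ⟩
    suc (2 * length w)                      ≤⟨ />2⇒< (length v) (length w) r>2 ⟩
    length v                                ∎
    where
    open ℕ.≤-Reasoning
    open +-*-Solver
  rest = prefix-total (periodic u) (w ++ w ++ [ a ]) v z-periodic v-periodic ∣z∣≤∣v∣
  v≡ = proj₂ rest

-- Palindromes of `t^ω[0]`

_≟ʷ_ : DecidableEquality (List Letter)
_≟ʷ_ = ≡-dec Fin._≟_

six : List (List Letter)
six = [] ∷ [ 0F ] ∷ [ 1F ] ∷ [ 2F ] ∷ (0F ∷ 0F ∷ []) ∷ (1F ∷ 1F ∷ []) ∷ []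

six-unique : Unique six
six-unique = from-yes (DecUnique.unique? _≟ʷ_ six)

⇝-antisym : ∀ {a b} → a ⇝ b → b ⇝ a → a ≡ b
⇝-antisym 0⇝0 0⇝0 = refl
⇝-antisym 1⇝1 1⇝1 = refl

⊑-reverse : ∀ {A : Set} {u w : List A} → u ⊑ w → reverse u ⊑ reverse w
⊑-reverse {u = u} (p , s , refl) = reverse s , reverse p ,
  trans (reverse-++ p (u ++ s)) (trans (cong (_++ reverse p) (reverse-++ u s)) (++-assoc (reverse s) (reverse u) (reverse p)))

-- Every step of the palindrome also occurs reversed, which forces equal letters. A cube `aaa` is an
-- overlap of period 1, and 22 is not a step.
palindrome-factor⇒∈six : ∀ {u} → Factors t^ω[0] u → Palindrome u → u List.∈ six
palindrome-factor⇒∈six {u} factor palindrome with Factors⇒⊑ factor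
... | N , occ = go u constant no-cube
  where
  step : ∀ {a b} → (a ∷ b ∷ []) ⊑ u → a ⇝ b
  step ab⊑u = Linked-⊑ (tⁿ[0]-⇝ N) (⊑-trans ab⊑u occ)
  constant : ∀ {a b} → (a ∷ b ∷ []) ⊑ u → a ⇝ b × a ≡ b
  constant {a} {b} ab⊑u = step ab⊑u , ⇝-antisym (step ab⊑u) (step (subst (reverse (a ∷ b ∷ []) ⊑_) palindrome (⊑-reverse ab⊑u)))
  no-cube : ∀ {a} → ¬ (a ∷ a ∷ a ∷ []) ⊑ u
  no-cube {a} aaa⊑u with Factors-⊑ t^ω[0] aaa⊑u factor
  ... | j , prefix = t^ω-overlap-free j 1 (s≤s z≤n) (factor-overlap _ a [] prefix)
  go : ∀ u → (∀ {a b} → (a ∷ b ∷ []) ⊑ u → a ⇝ b × a ≡ b) → (∀ {a} → ¬ (a ∷ a ∷ a ∷ []) ⊑ u) → u List.∈ six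
  go []            _ _ = here refl
  go (0F ∷ [])     _ _ = there (here refl)
  go (1F ∷ [])     _ _ = there (there (here refl))
  go (2F ∷ [])     _ _ = there (there (there (here refl)))
  go (a ∷ b ∷ u)   constant no-cube with constant ([] , u , refl)
  go (a ∷ b ∷ [])    constant no-cube | 0⇝0 , refl = there (there (there (there (here refl))))
  go (a ∷ b ∷ [])    constant no-cube | 1⇝1 , refl = there (there (there (there (there (here refl)))))
  go (a ∷ b ∷ c ∷ u) constant no-cube | _ , refl with constant ([ a ] , u , refl)
  ... | _ , refl = contradiction ([] , u , refl) no-cube

t^ω-palindromes : HasSize (Palindromes (Factors t^ω[0])) 6
t^ω-palindromes = six , six-unique ,
  (λ u → mk⇔ (λ u∈ → All.lookup six⊆ u∈) λ { (factor , palindrome) → palindrome-factor⇒∈six factor palindrome }) , refl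
  where
  at : ∀ n m → let w = tⁿ 2 [ 0F ] in Factors t^ω[0] (take m (drop n w))
  at n m = ⊑⇒Factors 2 {take m (drop n (tⁿ 2 [ 0F ]))} (take n w , drop m (drop n w) ,
      trans (sym (take++drop≡id n w)) (cong (take n w ++_) (sym (take++drop≡id m (drop n w)))))
    where w = tⁿ 2 [ 0F ]
  six⊆ : All (λ u → Factors t^ω[0] u × Palindrome u) six
  -- The positions refer to t²(0) = 011201200112001201120.
  six⊆ = (at 0 0 , refl) ∷ (at 0 1 , refl) ∷ (at 1 1 , refl) ∷ (at 3 1 , refl) ∷ (at 7 2 , refl) ∷ (at 1 2 , refl) ∷ []

-- Finite searches

-- Prepending letters to u one at a time, one meets P after at most n letters.
data Bar (P : Pred (List Letter) 0ℓ) : ℕ → List Letter → Set where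
  hit  : ∀ {n u} → P u → Bar P n u
  step : ∀ {n u} → (∀ a → Bar P n (a ∷ u)) → Bar P (suc n) u

bar? : ∀ {P} → Decidable P → ∀ n u → Dec (Bar P n u)
bar? P? zero    u = map′ hit (λ { (hit p) → p }) (P? u)
bar? P? (suc n) u with P? u
... | yes p = yes (hit p)
... | no ¬p = map′ step (λ { (hit p) → contradiction p ¬p ; (step f) → f })
                (Fin.all? (λ a → bar? P? n (a ∷ u)))

search : ∀ {P} (P? : Decidable P) n u → does (bar? P? n u) ≡ true → Bar P n u
search P? n u eq with bar? P? n u
... | yes bar = bar

-- The list `ys` holds the letters to the left of `u`, nearest first. The branch followed in the
-- tree is thus a prefix `x` of `ys`, and `x ʳ++ u` is the word read at its end.
bar-sound : ∀ {P n u} → Bar P n u → ∀ ys → n ≤ length ys →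
            ∃₂ λ x zs → ys ≡ x ++ zs × length x ≤ n × P (x ʳ++ u)
bar-sound (hit p)  ys       _       = [] , ys , refl , z≤n , p
bar-sound (step f) (a ∷ ys) (s≤s h) with bar-sound (f a) ys h
... | x , zs , refl , ∣x∣≤n , p = a ∷ x , zs , refl , s≤s ∣x∣≤n , p

ʳ++-++ : ∀ {A : Set} (x : List A) {y z} → x ʳ++ (y ++ z) ≡ (x ʳ++ y) ++ z
ʳ++-++ []      = refl
ʳ++-++ (a ∷ x) {y} {z} = ʳ++-++ x {a ∷ y} {z}

ʳ++-⊑ : ∀ {A : Set} (x : List A) {y} → y ⊑ x ʳ++ y
ʳ++-⊑ x {y} = reverse x , [] , trans (ʳ++-defn x) (cong (reverse x ++_) (sym (++-identityʳ y)))

bar-suffix : ∀ {P n} → Bar P n [] → ∀ w → n ≤ length w →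
             ∃₂ λ zs v → w ≡ zs ʳ++ v × length v ≤ n × P v
bar-suffix bar w n≤∣w∣
  with bar-sound bar (reverse w) (ℕ.≤-trans n≤∣w∣ (ℕ.≤-reflexive (sym (length-reverse w))))
... | x , zs , rev≡ , ∣x∣≤n , p = zs , x ʳ++ [] ,
  trans (sym (reverse-involutive w)) (trans (cong reverse rev≡) (++-ʳ++ x)) ,
  ℕ.≤-trans (ℕ.≤-reflexive (trans (length-ʳ++ x) (ℕ.+-identityʳ (length x)))) ∣x∣≤n , p

Prefix⇒++ : ∀ {u v : List Letter} → Prefix _≡_ u v → ∃[ r ] v ≡ u ++ r
Prefix⇒++ p with Prefix.toView p
... | u≋ PrefixView.++ r = r , cong (_++ r) (sym (Pointwise-≡⇒≡ u≋))

-- Desubstitution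

-- These are exactly the two-letter words that are not steps of `_⇝_`.
descents : List (List Letter)
descents = (1F ∷ 0F ∷ []) ∷ (2F ∷ 1F ∷ []) ∷ (0F ∷ 2F ∷ []) ∷ (2F ∷ 2F ∷ []) ∷ []

-- (y , z) stands for the power of yz of exponent 2 + |y| / |yz|.
roots : List (List Letter × List Letter)
roots =
  (0F ∷ [] , []) ∷
  (1F ∷ [] , []) ∷
  (0F ∷ [] , 1F ∷ 2F ∷ []) ∷
  (1F ∷ [] , 2F ∷ 0F ∷ []) ∷
  (1F ∷ [] , 2F ∷ 0F ∷ 0F ∷ []) ∷
  (0F ∷ [] , 1F ∷ 1F ∷ 2F ∷ []) ∷
  (0F ∷ 1F ∷ [] , 1F ∷ 2F ∷ 0F ∷ []) ∷
  (1F ∷ 2F ∷ 0F ∷ [] , 0F ∷ 1F ∷ []) ∷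
  (1F ∷ 2F ∷ 0F ∷ [] , 0F ∷ 1F ∷ 2F ∷ 0F ∷ 1F ∷ []) ∷
  (0F ∷ 1F ∷ [] , 1F ∷ 2F ∷ 0F ∷ 1F ∷ 2F ∷ 0F ∷ []) ∷
  []

forbidden : List (List Letter)
forbidden = descents ++ map square-plus roots

-- Ranging over all `n` makes goodness descend from a word to every `v` whose image it contains, as
-- iterates compose.
Good : List Letter → Set
Good w = ∀ n {s} → s List.∈ forbidden → ¬ tⁿ n s ⊑ w

tⁿ-+ : ∀ m n u → tⁿ (m + n) u ≡ tⁿ m (tⁿ n u)
tⁿ-+ m n u = fold-+ u t* m

Good-tⁿ : ∀ n {v w} → tⁿ n v ⊑ w → Good w → Good v
Good-tⁿ n {v} {w} tv⊑w good m {s} s∈ ts⊑v =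
  good (n + m) s∈ (⊑-trans (subst (_⊑ tⁿ n v) (sym (tⁿ-+ n m s)) (tⁿ-⊑ n ts⊑v)) tv⊑w)

-- The searches grow words on the left, so a new forbidden factor always shows up at the front.
BadStart : Pred (List Letter) 0ℓ
BadStart v = Any (λ s → Prefix _≡_ s v) forbidden

badStart? : Decidable BadStart
badStart? v = any? (λ s → prefix? Fin._≟_ s v) forbidden

BadStart⇒¬Good : ∀ {v w} → BadStart v → v ⊑ w → ¬ Good w
BadStart⇒¬Good bad v⊑w good with List.find bad
... | s , s∈ , p with Prefix⇒++ p
... | r , refl = good 0 s∈ (⊑-trans ([] , r , refl) v⊑w)

-- The beginnings of V from which t* V determines the block to its left.
contexts : List (List Letter)
contexts = (0F ∷ 0F ∷ []) ∷ (0F ∷ 1F ∷ []) ∷ (1F ∷ 1F ∷ []) ∷ (1F ∷ 2F ∷ 0F ∷ []) ∷ (2F ∷ 0F ∷ []) ∷ []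

-- Requiring `c ∷ k` to begin with a context again is what allows the next block to be read in the
-- same way.
NextBlock : List Letter → Pred (List Letter) 0ℓ
NextBlock k v = ∃[ c ] v ≡ t c ++ t* k × Any (λ k′ → Prefix _≡_ k′ (c ∷ k)) contexts

nextBlock? : ∀ k → Decidable (NextBlock k)
nextBlock? k v = Fin.any? λ c → (v ≟ʷ (t c ++ t* k)) ×-dec any? (λ k′ → prefix? Fin._≟_ k′ (c ∷ k)) contexts

abstract
  block-bars : All (λ k → ∀ a → Bar (λ v → BadStart v ⊎ NextBlock k v) 7 (a ∷ t* k)) contexts
  block-bars = from-yes (all? (λ k → Fin.all? λ a → bar? (λ v → badStart? v ⊎-dec nextBlock? k v) 7 (a ∷ t* k)) contexts)

-- Parsing starts from an occurrence of t(01) = 0112012001, which good words cannot avoid for long;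
-- 01 is itself one of the `contexts`.
marker : List Letter
marker = 0F ∷ 1F ∷ []

abstract
  marker-bar : Bar (λ v → BadStart v ⊎ Prefix _≡_ (t* marker) v) 30 []
  marker-bar = search (λ v → badStart? v ⊎-dec prefix? Fin._≟_ (t* marker) v) 30 [] refl

-- Blocks are split off leftwards; `ys` is the unread part, nearest letter first. Finding a block
-- may inspect the letter `a` and seven more, so parsing goes on while more than 8 letters are left.
-- The bound `m` carries the recursion.
parse : ∀ m ys k v q → length ys ≤ m → k List.∈ contexts → Good (ys ʳ++ (t* (k ++ v) ++ q)) →
        ∃₂ λ p v′ → ys ʳ++ (t* (k ++ v) ++ q) ≡ p ++ t* v′ ++ q × length p ≤ 8
parse m ys k v q ∣ys∣≤m k∈ good with length ys ≤? 8
... | yes short = reverse ys , k ++ v , ʳ++-defn ys , ℕ.≤-trans (ℕ.≤-reflexive (length-reverse ys)) short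
parse m       []       k v q ∣ys∣≤m       k∈ good | no long = contradiction z≤n long
parse (suc m) (a ∷ ys) k v q (s≤s ∣ys∣≤m) k∈ good | no long
  with bar-sound (All.lookup block-bars k∈ a) ys (ℕ.≤-pred (ℕ.<⇒≤ (ℕ.≰⇒> long)))
... | x , zs , refl , _ , found = conclude found
  where
  open ≡-Reasoning
  w = (a ∷ x ++ zs) ʳ++ (t* (k ++ v) ++ q)

  w≡ : w ≡ zs ʳ++ ((x ʳ++ (a ∷ t* k)) ++ t* v ++ q)
  w≡ = begin
    (x ++ zs) ʳ++ (a ∷ t* (k ++ v) ++ q)      ≡⟨ ++-ʳ++ x ⟩
    zs ʳ++ (x ʳ++ (a ∷ t* (k ++ v) ++ q))     ≡⟨ cong (λ u → zs ʳ++ (x ʳ++ (a ∷ u ++ q))) (concatMap-++ t k v) ⟩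
    zs ʳ++ (x ʳ++ (a ∷ (t* k ++ t* v) ++ q))  ≡⟨ cong (λ u → zs ʳ++ (x ʳ++ (a ∷ u))) (++-assoc (t* k) (t* v) q) ⟩
    zs ʳ++ (x ʳ++ ((a ∷ t* k) ++ t* v ++ q))  ≡⟨ cong (zs ʳ++_) (ʳ++-++ x) ⟩
    zs ʳ++ ((x ʳ++ (a ∷ t* k)) ++ t* v ++ q)  ∎

  conclude : BadStart (x ʳ++ (a ∷ t* k)) ⊎ NextBlock k (x ʳ++ (a ∷ t* k)) →
             ∃₂ λ p v′ → w ≡ p ++ t* v′ ++ q × length p ≤ 8
  conclude (inj₁ bad) = contradiction (subst Good w≡ good)
    (BadStart⇒¬Good bad (⊑-trans ([] , t* v ++ q , refl) (ʳ++-⊑ zs)))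
  conclude (inj₂ (c , block , new)) with List.find new
  ... | k′ , k′∈ , pre with Prefix⇒++ pre
  ... | r , c∷k≡ =
    let p , v′ , eq , ∣p∣≤8 = parse m zs k′ (r ++ v) q
                                (ℕ.≤-trans (ℕ.≤-trans (ℕ.m≤n+m _ (length x)) (ℕ.≤-reflexive (sym (length-++ x)))) ∣ys∣≤m)
                                k′∈ (subst Good w≡′ good)
    in  p , v′ , trans w≡′ eq , ∣p∣≤8
    where
    w≡′ : w ≡ zs ʳ++ (t* (k′ ++ r ++ v) ++ q)
    w≡′ = trans w≡ (cong (zs ʳ++_) (begin
      (x ʳ++ (a ∷ t* k)) ++ t* v ++ q  ≡⟨ cong (_++ t* v ++ q) block ⟩
      t* (c ∷ k) ++ t* v ++ q          ≡⟨ ++-assoc (t* (c ∷ k)) (t* v) q ⟨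
      (t* (c ∷ k) ++ t* v) ++ q        ≡⟨ cong (_++ q) (concatMap-++ t (c ∷ k) v) ⟨
      t* ((c ∷ k) ++ v) ++ q           ≡⟨ cong (λ u → t* (u ++ v) ++ q) c∷k≡ ⟩
      t* ((k′ ++ r) ++ v) ++ q         ≡⟨ cong (λ u → t* u ++ q) (++-assoc k′ r v) ⟩
      t* (k′ ++ r ++ v) ++ q           ∎))

unavoidable : ∀ {n s} → Bar (λ v → BadStart v ⊎ Prefix _≡_ s v) n [] → ∀ w → n ≤ length w → Good w →
              ∃₂ λ zs q → w ≡ zs ʳ++ (s ++ q) × length q ≤ n
unavoidable {n} {s} bar w n≤∣w∣ good with bar-suffix bar w n≤∣w∣
... | zs , v , refl , _    , inj₁ bad = contradiction good (BadStart⇒¬Good bad (ʳ++-⊑ zs))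
... | zs , v , refl , ∣v∣≤ , inj₂ pre with Prefix⇒++ pre
... | q , refl = zs , q , refl ,
  ℕ.≤-trans (length-⊑ (s , [] , cong (s ++_) (sym (++-identityʳ q)))) ∣v∣≤

-- Parsing runs leftwards from a marker near the right end. The letters after that marker form the
-- right margin, and those left unparsed form the left one.
desubstitute : ∀ v → Good v →
               ∃₂ λ p v′ → ∃[ q ] v ≡ p ++ t* v′ ++ q × length p ≤ 30 × length q ≤ 30
desubstitute v good with length v ≤? 30
... | yes short = v , [] , [] , sym (++-identityʳ v) , short , z≤n
... | no long with unavoidable {s = t* marker} marker-bar v (ℕ.<⇒≤ (ℕ.≰⇒> long)) good
... | zs , q , refl , ∣q∣≤30 =
  let p , v′ , eq , ∣p∣≤8 = parse (length zs) zs marker [] q ℕ.≤-refl (there (here refl)) good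
  in  p , v′ , q , eq , ℕ.≤-trans ∣p∣≤8 (ℕ.m≤m+n 8 22) , ∣q∣≤30

length-t*≤ : ∀ u → length (t* u) ≤ 5 * length u
length-t*≤ []      = z≤n
length-t*≤ (a ∷ u) = begin
  length (t a ++ t* u)        ≡⟨ length-++ (t a) ⟩
  length (t a) + length (t* u) ≤⟨ ℕ.+-mono-≤ (length-t≤ a) (length-t*≤ u) ⟩
  5 + 5 * length u            ≡⟨ ℕ.*-suc 5 (length u) ⟨
  5 * suc (length u)          ∎
  where
  open ℕ.≤-Reasoning
  length-t≤ : ∀ a → length (t a) ≤ 5
  length-t≤ 0F = ℕ.≤-refl
  length-t≤ 1F = ℕ.≤-refl
  length-t≤ 2F = s≤s z≤n

length-tⁿ≤ : ∀ n u → length (tⁿ n u) ≤ 5 ^ n * length u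
length-tⁿ≤ zero    u = ℕ.≤-reflexive (sym (ℕ.*-identityˡ (length u)))
length-tⁿ≤ (suc n) u = begin
  length (t* (tⁿ n u))        ≤⟨ length-t*≤ (tⁿ n u) ⟩
  5 * length (tⁿ n u)         ≤⟨ ℕ.*-monoʳ-≤ 5 (length-tⁿ≤ n u) ⟩
  5 * (5 ^ n * length u)      ≡⟨ ℕ.*-assoc 5 (5 ^ n) (length u) ⟨
  5 ^ suc n * length u        ∎
  where open ℕ.≤-Reasoning

-- This is the sum of 30 · 5^i over i < n: each level loses at most 30 letters per side, and those
-- of level i are stretched by at most 5^i.
margin : ℕ → ℕ
margin zero    = 0
margin (suc n) = margin n + 5 ^ n * 30

desubstituteⁿ : ∀ n w → Good w → ∃₂ λ p v → ∃[ q ]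
                w ≡ p ++ tⁿ n v ++ q × length p ≤ margin n × length q ≤ margin n × Good v
desubstituteⁿ zero    w good = [] , w , [] , sym (++-identityʳ w) , z≤n , z≤n , good
desubstituteⁿ (suc n) w good with desubstituteⁿ n w good
... | p , v , q , refl , ∣p∣≤ , ∣q∣≤ , good-v with desubstitute v good-v
... | p′ , v′ , q′ , refl , ∣p′∣≤ , ∣q′∣≤ =
  p ++ tⁿ n p′ , v′ , tⁿ n q′ ++ q , eq ,
  (let open ℕ.≤-Reasoning in begin
    length (p ++ tⁿ n p′)            ≡⟨ length-++ p ⟩
    length p + length (tⁿ n p′)      ≤⟨ ℕ.+-mono-≤ ∣p∣≤ (bound p′ ∣p′∣≤) ⟩
    margin n + 5 ^ n * 30            ∎) ,
  (let open ℕ.≤-Reasoning in begin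
    length (tⁿ n q′ ++ q)            ≡⟨ length-++ (tⁿ n q′) ⟩
    length (tⁿ n q′) + length q      ≤⟨ ℕ.+-mono-≤ (bound q′ ∣q′∣≤) ∣q∣≤ ⟩
    5 ^ n * 30 + margin n            ≡⟨ ℕ.+-comm (5 ^ n * 30) (margin n) ⟩
    margin n + 5 ^ n * 30            ∎) ,
  Good-tⁿ 1 {v′} (p′ , q′ , refl) good-v
  where
  bound : ∀ u → length u ≤ 30 → length (tⁿ n u) ≤ 5 ^ n * 30
  bound u ∣u∣≤ = ℕ.≤-trans (length-tⁿ≤ n u) (ℕ.*-monoʳ-≤ (5 ^ n) ∣u∣≤)
  tⁿ-suc : ∀ n u → tⁿ n (t* u) ≡ tⁿ (suc n) u
  tⁿ-suc zero    u = refl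
  tⁿ-suc (suc n) u = cong t* (tⁿ-suc n u)
  eq : p ++ tⁿ n (p′ ++ t* v′ ++ q′) ++ q ≡ (p ++ tⁿ n p′) ++ tⁿ (suc n) v′ ++ tⁿ n q′ ++ q
  eq = begin
    p ++ tⁿ n (p′ ++ t* v′ ++ q′) ++ q                       ≡⟨ cong (λ u → p ++ u ++ q) (tⁿ-++ n p′ _) ⟩
    p ++ (tⁿ n p′ ++ tⁿ n (t* v′ ++ q′)) ++ q                ≡⟨ cong (p ++_) (++-assoc (tⁿ n p′) _ q) ⟩
    p ++ tⁿ n p′ ++ tⁿ n (t* v′ ++ q′) ++ q                  ≡⟨ ++-assoc p (tⁿ n p′) _ ⟨
    (p ++ tⁿ n p′) ++ tⁿ n (t* v′ ++ q′) ++ q                ≡⟨ cong (λ u → (p ++ tⁿ n p′) ++ u ++ q) (tⁿ-++ n (t* v′) q′) ⟩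
    (p ++ tⁿ n p′) ++ (tⁿ n (t* v′) ++ tⁿ n q′) ++ q         ≡⟨ cong ((p ++ tⁿ n p′) ++_) (++-assoc (tⁿ n (t* v′)) (tⁿ n q′) q) ⟩
    (p ++ tⁿ n p′) ++ tⁿ n (t* v′) ++ tⁿ n q′ ++ q           ≡⟨ cong (λ u → (p ++ tⁿ n p′) ++ u ++ tⁿ n q′ ++ q) (tⁿ-suc n v′) ⟩
    (p ++ tⁿ n p′) ++ tⁿ (suc n) v′ ++ tⁿ n q′ ++ q          ∎
    where open ≡-Reasoning

-- Bi-infinite words

-- As |t(2)| = 1, exponents can drop under t; measured by the letters other than 2 they do not.
weight : List Letter → ℕ
weight []       = 0
weight (0F ∷ u) = suc (weight u)
weight (1F ∷ u) = suc (weight u)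
weight (2F ∷ u) = weight u

weight-t* : ∀ u → weight (t* u) ≡ 4 * weight u
weight-t* []       = refl
weight-t* (0F ∷ u) = trans (cong (λ n → 4 + n) (weight-t* u)) (sym (ℕ.*-suc 4 (weight u)))
weight-t* (1F ∷ u) = trans (cong (λ n → 4 + n) (weight-t* u)) (sym (ℕ.*-suc 4 (weight u)))
weight-t* (2F ∷ u) = weight-t* u

length-t* : ∀ u → length (t* u) ≡ 4 * weight u + length u
length-t* []       = refl
length-t* (0F ∷ u) = trans (cong (λ n → 5 + n) (length-t* u))
  (solve 2 (λ a b → con 5 :+ (con 4 :* a :+ b) := con 4 :* (con 1 :+ a) :+ (con 1 :+ b)) refl (weight u) (length u))
  where open +-*-Solver
length-t* (1F ∷ u) = trans (cong (λ n → 5 + n) (length-t* u))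
  (solve 2 (λ a b → con 5 :+ (con 4 :* a :+ b) := con 4 :* (con 1 :+ a) :+ (con 1 :+ b)) refl (weight u) (length u))
  where open +-*-Solver
length-t* (2F ∷ u) = trans (cong suc (length-t* u)) (sym (ℕ.+-suc (4 * weight u) (length u)))

weight-tⁿ>0 : ∀ n {u} → 0 < weight u → 0 < weight (tⁿ n u)
weight-tⁿ>0 zero        h = h
weight-tⁿ>0 (suc n) {u} h rewrite weight-t* (tⁿ n u) = ℕ.≤-trans (weight-tⁿ>0 n h) (ℕ.m≤n*m _ 4)

-- Each application of `t` adds four letters for every letter other than 2, hence at least one. This
-- crude growth is all that `short-ancestor` needs.
length-tⁿ≥ : ∀ n {u} → 0 < weight u → n + length u ≤ length (tⁿ n u)
length-tⁿ≥ zero        h = ℕ.≤-refl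
length-tⁿ≥ (suc n) {u} h rewrite length-t* (tⁿ n u) =
  ℕ.+-mono-≤ {1} (ℕ.≤-trans (weight-tⁿ>0 n h) (ℕ.m≤n*m _ 4)) (length-tⁿ≥ n h)

_≤4×_ : List Letter → List Letter → Set
x ≤4× y = weight x ≤ 4 * weight y × length x ≤ 4 * length y

-- The weight and length of an image are nonnegative combinations of the weight and length of the
-- word, so the two bounds are inherited together.
tⁿ-≤4× : ∀ n {x y} → x ≤4× y → tⁿ n x ≤4× tⁿ n y
tⁿ-≤4× zero    h = h
tⁿ-≤4× (suc n) {x} {y} h with tⁿ-≤4× n {x} {y} h
... | w , l rewrite weight-t* (tⁿ n x) | weight-t* (tⁿ n y) | length-t* (tⁿ n x) | length-t* (tⁿ n y) =
  ℕ.*-monoʳ-≤ 4 w ,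
  ℕ.≤-trans (ℕ.+-mono-≤ (ℕ.*-monoʳ-≤ 4 w) l) (ℕ.≤-reflexive (sym (ℕ.*-distribˡ-+ 4 (4 * weight (tⁿ n y)) (length (tⁿ n y)))))

tⁿ-square-plus : ∀ n y z → tⁿ n (square-plus (y , z)) ≡ square-plus (tⁿ n y , tⁿ n z)
tⁿ-square-plus n y z = trans (tⁿ-++ n (y ++ z) _)
  (cong₂ _++_ (tⁿ-++ n y z) (trans (tⁿ-++ n (y ++ z) y) (cong (_++ tⁿ n y) (tⁿ-++ n y z))))

roots-heavy : All (λ (y , z) → 0 < weight y × (y ++ z) ≤4× y) roots
roots-heavy = from-yes (all? (λ (y , z) → (0 <? weight y) ×-dec (weight (y ++ z) ≤? 4 * weight y) ×-dec (length (y ++ z) ≤? 4 * length y)) roots)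

-- Factors of images come from short words

infix-of-++ : ∀ {A : Set} (x : List A) {y u} → u ⊑ x ++ y →
              u ⊑ y ⊎ ∃₂ λ r s → y ≡ r ++ s × length r ≤ length u × u ⊑ x ++ r
infix-of-++ x {y} {u} (p , s , eq) with length x ≤? length p
... | yes x≤p with ++-split x p x≤p (sym eq)
... | r , refl , eq′ = inj₁ (r , s , sym eq′)
infix-of-++ x {y} {u} (p , s , eq) | no x≰p with ++-split p x (ℕ.<⇒≤ (ℕ.≰⇒> x≰p)) eq
... | r , refl , eq′ with length u ≤? length r
... | yes u≤r with ++-split u r u≤r eq′
... | r′ , refl , _ = inj₂ ([] , y , refl , z≤n , ⊑-++ʳ [] (p , r′ , refl))
infix-of-++ x {y} {u} (p , s , eq) | no x≰p | r , refl , eq′ | no u≰r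
  with ++-split r u (ℕ.<⇒≤ (ℕ.≰⇒> u≰r)) (sym eq′)
... | r′ , refl , eq″ = inj₂ (r′ , s , sym eq″ ,
  length-⊑ {u = r′} (r , [] , cong (r ++_) (sym (++-identityʳ r′))) ,
  (p , [] , trans (++-assoc p r r′) (cong (p ++_) (sym (++-identityʳ (r ++ r′))))))

-- If `u` starts in the image of `a`, it reaches at most `n` letters beyond it. The next two letters
-- are not 22, so their image has at least n + 2 letters, and three letters suffice.
short-ancestor : ∀ n u v → length u ≤ n → Good v → u ⊑ tⁿ n v →
                 ∃[ v′ ] length v′ ≤ 3 × v′ ⊑ v × u ⊑ tⁿ n v′
short-ancestor n u []      _    _    u⊑ = [] , z≤n , ⊑-refl , u⊑
short-ancestor n u (a ∷ v) ∣u∣≤ good u⊑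
  with infix-of-++ (tⁿ n [ a ]) (subst (u ⊑_) (tⁿ-++ n [ a ] v) u⊑)
... | inj₁ u⊑tv =
  let v′ , ∣v′∣≤3 , v′⊑v , u⊑v′ = short-ancestor n u v ∣u∣≤ (Good-tⁿ 0 {v} (⊑-++ˡ [ a ] ⊑-refl) good) u⊑tv
  in  v′ , ∣v′∣≤3 , ⊑-++ˡ [ a ] v′⊑v , u⊑v′
... | inj₂ (r , s , tv≡ , ∣r∣≤ , u⊑ar) = front v good u⊑ tv≡
  where
  heavy : ∀ b c {v} → Good (a ∷ b ∷ c ∷ v) → 0 < weight (b ∷ c ∷ [])
  heavy 0F _  _ = s≤s z≤n
  heavy 1F _  _ = s≤s z≤n
  heavy 2F 0F _ = s≤s z≤n
  heavy 2F 1F _ = s≤s z≤n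
  heavy 2F 2F {v} good = contradiction ([ a ] , v , refl) (good 0 (there (there (there (here refl)))))

  front : ∀ v → Good (a ∷ v) → u ⊑ tⁿ n (a ∷ v) → tⁿ n v ≡ r ++ s →
          ∃[ v′ ] length v′ ≤ 3 × v′ ⊑ (a ∷ v) × u ⊑ tⁿ n v′
  front []          _    u⊑ _   = _ , s≤s z≤n , ⊑-refl , u⊑
  front (b ∷ [])    _    u⊑ _   = _ , s≤s (s≤s z≤n) , ⊑-refl , u⊑
  front (b ∷ c ∷ v) good u⊑ tv≡ with ++-split r (tⁿ n (b ∷ c ∷ [])) {tⁿ n v} {s}
    (ℕ.≤-trans ∣r∣≤ (ℕ.≤-trans ∣u∣≤ (ℕ.≤-trans (ℕ.m≤m+n n 2) (length-tⁿ≥ n (heavy b c good)))))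
    (trans (sym (tⁿ-++ n (b ∷ c ∷ []) v)) tv≡)
  ... | r′ , tbc≡ , _ = a ∷ b ∷ c ∷ [] , ℕ.≤-refl , ([] , v , refl) ,
    ⊑-trans u⊑ar ([] , r′ , (begin
      tⁿ n (a ∷ b ∷ c ∷ [])            ≡⟨ tⁿ-++ n [ a ] (b ∷ c ∷ []) ⟩
      tⁿ n [ a ] ++ tⁿ n (b ∷ c ∷ [])  ≡⟨ cong (tⁿ n [ a ] ++_) tbc≡ ⟩
      tⁿ n [ a ] ++ r ++ r′            ≡⟨ ++-assoc (tⁿ n [ a ]) r r′ ⟨
      (tⁿ n [ a ] ++ r) ++ r′          ∎))
    where open ≡-Reasoning

Infix⇒⊑ : ∀ {u v : List Letter} → Infix _≡_ u v → u ⊑ v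
Infix⇒⊑ i with Infix.toView i
... | View.MkView p u≋ s rewrite Pointwise-≡⇒≡ u≋ = p , s , refl

Good-short : ∀ v → Good v → length v ≤ 3 → v ⊑ tⁿ 2 [ 0F ]
Good-short v good ∣v∣≤3 = decided (found v ∣v∣≤3)
  where
  Found : Pred (List Letter) 0ℓ
  Found v = Any (λ s → Infix _≡_ s v) forbidden ⊎ Infix _≡_ v (tⁿ 2 [ 0F ])
  found? : Decidable Found
  found? v = any? (λ s → infix? Fin._≟_ s v) forbidden ⊎-dec infix? Fin._≟_ v (tⁿ 2 [ 0F ])
  found : ∀ v → length v ≤ 3 → Found v
  found []               _ = from-yes (found? [])
  found (a ∷ [])         _ = from-yes (Fin.all? λ a → found? (a ∷ [])) a
  found (a ∷ b ∷ [])     _ = from-yes (Fin.all? λ a → Fin.all? λ b → found? (a ∷ b ∷ [])) a b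
  found (a ∷ b ∷ c ∷ []) _ = from-yes (Fin.all? λ a → Fin.all? λ b → Fin.all? λ c → found? (a ∷ b ∷ c ∷ [])) a b c
  found (_ ∷ _ ∷ _ ∷ _ ∷ _) (s≤s (s≤s (s≤s ())))
  decided : Found v → v ⊑ tⁿ 2 [ 0F ]
  decided (inj₂ v⊑)  = Infix⇒⊑ v⊑
  decided (inj₁ bad) = let s , s∈ , s⊑ = List.find bad in contradiction (Infix⇒⊑ s⊑) (good 0 s∈)

-- Palindromes and the orientation of the cycle

six-short : ∀ {v} → v List.∈ six → length v ≤ 2
six-short = All.lookup (from-yes (all? (λ v → length v ≤? 2) six))

SixPalindromes : Pred (List Letter) 0ℓ
SixPalindromes w = ∀ {v} → v ⊑ w → Palindrome v → v List.∈ six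

⇝-total : ∀ a b → ¬ (a ≡ 2F × b ≡ 2F) → a ⇝ b ⊎ b ⇝ a
⇝-total 0F 0F _ = inj₁ 0⇝0
⇝-total 0F 1F _ = inj₁ 0⇝1
⇝-total 0F 2F _ = inj₂ 2⇝0
⇝-total 1F 0F _ = inj₂ 0⇝1
⇝-total 1F 1F _ = inj₁ 1⇝1
⇝-total 1F 2F _ = inj₁ 1⇝2
⇝-total 2F 0F _ = inj₁ 2⇝0
⇝-total 2F 1F _ = inj₂ 1⇝2
⇝-total 2F 2F h = contradiction (refl , refl) h

⇝-successor : ∀ {a b c} → b ⇝ a → b ⇝ c → a ≢ b → c ≡ b ⊎ c ≡ a
⇝-successor 0⇝0 _   a≢b = contradiction refl a≢b
⇝-successor 0⇝1 0⇝0 _   = inj₁ refl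
⇝-successor 0⇝1 0⇝1 _   = inj₂ refl
⇝-successor 1⇝1 _   a≢b = contradiction refl a≢b
⇝-successor 1⇝2 1⇝1 _   = inj₁ refl
⇝-successor 1⇝2 1⇝2 _   = inj₂ refl
⇝-successor 2⇝0 2⇝0 _   = inj₂ refl

⇝-predecessor : ∀ {a b c} → a ⇝ b → c ⇝ b → a ≢ b → c ≡ b ⊎ c ≡ a
⇝-predecessor 0⇝0 _   a≢b = contradiction refl a≢b
⇝-predecessor 0⇝1 0⇝1 _   = inj₂ refl
⇝-predecessor 0⇝1 1⇝1 _   = inj₁ refl
⇝-predecessor 1⇝1 _   a≢b = contradiction refl a≢b
⇝-predecessor 1⇝2 1⇝2 _   = inj₂ refl
⇝-predecessor 2⇝0 0⇝0 _   = inj₁ refl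
⇝-predecessor 2⇝0 2⇝0 _   = inj₂ refl

-- A change of direction creates one of the palindromes aba, bbb, abba within three letters.
turn : ∀ {R : Letter → Letter → Set} → (∀ {a b c} → R b a → R b c → a ≢ b → c ≡ b ⊎ c ≡ a) →
       ∀ {a b w} → SixPalindromes (a ∷ b ∷ w) → R b a → a ≢ b → Linked R (b ∷ w) →
       Linked (flip R) (a ∷ b ∷ w)
turn next six-pal ba a≢b [-] = ba ∷ [-]
turn next {a} six-pal ba a≢b (_∷_ {xs = w} bc l) with next ba bc a≢b
... | inj₂ refl = contradiction (six-short (six-pal ([] , w , refl) refl)) λ { (s≤s (s≤s ())) }
turn next six-pal ba a≢b (bb ∷ [-]) | inj₁ refl = ba ∷ bb ∷ [-]
turn next {a} six-pal ba a≢b (bb ∷ (_∷_ {xs = w} bd l)) | inj₁ refl with next ba bd a≢b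
... | inj₁ refl = contradiction (six-short (six-pal ([ a ] , w , refl) refl)) λ { (s≤s (s≤s ())) }
... | inj₂ refl = contradiction (six-short (six-pal ([] , w , refl) refl)) λ { (s≤s (s≤s ())) }

-- Letters are added on the left. A first step against the orientation of the rest leaves only `b`
-- or `bb` as that rest, which carries both orientations.
orient : ∀ w → SixPalindromes w → Linked _⇝_ w ⊎ Linked (flip _⇝_) w
orient []          _ = inj₁ []
orient (a ∷ [])    _ = inj₁ [-]
orient (a ∷ b ∷ w) six-pal with orient (b ∷ w) (λ v⊑ → six-pal (⊑-++ˡ [ a ] v⊑)) | ⇝-total a b ≢22 | a Fin.≟ b
  where
  ≢22 : ¬ (a ≡ 2F × b ≡ 2F)
  ≢22 (refl , refl) with six-pal ([] , w , refl) refl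
  ... | there (there (there (there (there (there ())))))
... | inj₁ l | inj₁ ab | _        = inj₁ (ab ∷ l)
... | inj₁ l | inj₂ ba | yes refl = inj₁ (ba ∷ l)
... | inj₁ l | inj₂ ba | no a≢b   = inj₂ (turn ⇝-successor six-pal ba a≢b l)
... | inj₂ l | inj₂ ba | _        = inj₂ (ba ∷ l)
... | inj₂ l | inj₁ ab | yes refl = inj₂ (ab ∷ l)
... | inj₂ l | inj₁ ab | no a≢b   = inj₁ (turn ⇝-predecessor six-pal ab a≢b l)

-- Words oriented along the cycle

Descent : Pred (List Letter) 0ℓ
Descent s = ∃₂ λ a b → s ≡ a ∷ b ∷ [] × ¬ a ⇝ b × s ⊑ t* s

-- Since each `s` recurs in `t* s`, it recurs in all `tⁿ n s`; excluding `s` therefore excludes all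
-- its iterates.
descents-descend : All Descent descents
descents-descend =
  (_ , _ , refl , (λ ()) , (1F ∷ 2F ∷ 0F ∷ 0F ∷ [] , 1F ∷ 1F ∷ 2F ∷ 0F ∷ [] , refl)) ∷
  (_ , _ , refl , (λ ()) , ([] , 2F ∷ 0F ∷ 0F ∷ 1F ∷ [] , refl)) ∷
  (_ , _ , refl , (λ ()) , (0F ∷ 1F ∷ 1F ∷ 2F ∷ [] , [] , refl)) ∷
  (_ , _ , refl , (λ ()) , ([] , [] , refl)) ∷ []

⊑-tⁿ : ∀ n {u} → u ⊑ t* u → u ⊑ tⁿ n u
⊑-tⁿ zero    h = ⊑-refl
⊑-tⁿ (suc n) h = ⊑-trans h (tⁿ-⊑ 1 (⊑-tⁿ n h))

abstract
  -- A good word avoids 0 for at most three letters, as in 112.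
  0-bar : Bar (λ v → BadStart v ⊎ Prefix _≡_ [ 0F ] v) 4 []
  0-bar = search (λ v → badStart? v ⊎-dec prefix? Fin._≟_ [ 0F ] v) 4 [] refl

module Oriented
  (w : BiInfinite Letter)
  (free : ∀ y z → 0 < length y → length (y ++ z) ≤ 4 * length y → ¬ Factorsℤ w (square-plus (y , z)))
  (six-pal : ∀ {v} → Factorsℤ w v → Palindrome v → v List.∈ six)
  (01∈ : Factorsℤ w (0F ∷ 1F ∷ []))
  where

  -- A factor containing both `ab` and 01 has an orientation, and 01 rules out the reversed one.
  factor-step : ∀ {a b} → Factorsℤ w (a ∷ b ∷ []) → a ⇝ b
  factor-step ab∈ with Factorsℤ-directed w ab∈ 01∈
  ... | z , z∈ , ab⊑z , 01⊑z with orient z (λ v⊑z → six-pal (Factorsℤ-⊑ w v⊑z z∈))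
  ... | inj₁ l = Linked-⊑ l ab⊑z
  ... | inj₂ l with Linked-⊑ l 01⊑z
  ... | ()

  -- An iterate of a descent contains the descent, which is not a step. An iterate of a listed power
  -- is again a `square-plus`, and `tⁿ-≤4×` keeps its exponent at least 9/4.
  factor-Good : ∀ {v} → Factorsℤ w v → Good v
  factor-Good {v} v∈ n s∈ ts⊑v with ∈-++⁻ descents s∈
  ... | inj₁ s∈descents with All.lookup descents-descend s∈descents
  ... | a , b , refl , ¬ab , s⊑ts = ¬ab (factor-step (Factorsℤ-⊑ w (⊑-trans (⊑-tⁿ n s⊑ts) ts⊑v) v∈))
  factor-Good {v} v∈ n s∈ ts⊑v | inj₂ s∈powers with ∈-map⁻ square-plus s∈powers
  ... | (y , z) , yz∈ , refl with All.lookup roots-heavy yz∈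
  ... | 0<y , yz≤4y = free (tⁿ n y) (tⁿ n z)
    (ℕ.≤-trans (ℕ.≤-trans (0<length {y} 0<y) (ℕ.m≤n+m _ n)) (length-tⁿ≥ n 0<y))
    (subst (λ x → length x ≤ 4 * length (tⁿ n y)) (tⁿ-++ n y z) (proj₂ (tⁿ-≤4× n {y ++ z} {y} yz≤4y)))
    (Factorsℤ-⊑ w (subst (_⊑ v) (tⁿ-square-plus n y z) ts⊑v) v∈)
    where
    0<length : ∀ {u} → 0 < weight u → 0 < length u
    0<length {_ ∷ _} _ = s≤s z≤n

  factor⇒t^ω : ∀ {u} → Factorsℤ w u → Factors t^ω[0] u
  factor⇒t^ω {u} u∈ =
    -- Level |u| is what `short-ancestor` requires; padding by `margin n` on both sides keeps `u`
    -- within the core.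
    let n = length u
        l , r , ∣l∣≡ , ∣r∣≡ , lur∈ = Factorsℤ-extend w u∈ (margin n) (margin n)
        p , v , q , eq , ∣p∣≤ , ∣q∣≤ , good = desubstituteⁿ n (l ++ u ++ r) (factor-Good lur∈)
        u⊑ = ⊑-middle l u r p (tⁿ n v) q eq (subst (length p ≤_) (sym ∣l∣≡) ∣p∣≤) (subst (length q ≤_) (sym ∣r∣≡) ∣q∣≤)
        v′ , ∣v′∣≤3 , v′⊑v , u⊑v′ = short-ancestor n u v ℕ.≤-refl good u⊑
        v′⊑t²0 = Good-short v′ (Good-tⁿ 0 {v′} v′⊑v good) ∣v′∣≤3
    in  ⊑⇒Factors (n + 2) (subst (u ⊑_) (sym (tⁿ-+ n 2 [ 0F ])) (⊑-trans u⊑v′ (tⁿ-⊑ n v′⊑t²0)))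

  []∈ : Factorsℤ w []
  []∈ = + 0 , λ ()

  t^ω⇒factor : ∀ {u} → Factors t^ω[0] u → Factorsℤ w u
  t^ω⇒factor {u} u∈ with Factors⇒⊑ {u} u∈
  -- After both margins are lost, at least 4 · 5^n letters of `tⁿ n v` remain. So `v` has at least
  -- four letters and contains 0, and `tⁿ n [ 0F ]` occurs in `w`.
  ... | n , u⊑tⁿ0 with Factorsℤ-extend w []∈ (margin n + (5 ^ n * 4 + margin n)) 0
  ... | l , r , ∣l∣≡ , _ , lr∈ with Factorsℤ-⊑ w {u = l} ([] , r , refl) lr∈
  ... | l∈ with desubstituteⁿ n l (factor-Good l∈)
  ... | p , v , q , refl , ∣p∣≤ , ∣q∣≤ , good with unavoidable {s = [ 0F ]} 0-bar v 4≤∣v∣ good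
    where
    open ℕ.≤-Reasoning
    m = margin n
    4≤∣v∣ : 4 ≤ length v
    4≤∣v∣ = ℕ.*-cancelˡ-≤ (5 ^ n) {{ℕ.m^n≢0 5 n}} (ℕ.+-cancelʳ-≤ m _ _ (ℕ.+-cancelˡ-≤ m _ _ (begin
      m + (5 ^ n * 4 + m)                          ≡⟨ ∣l∣≡ ⟨
      length (p ++ tⁿ n v ++ q)                    ≡⟨ length-++ p ⟩
      length p + length (tⁿ n v ++ q)              ≡⟨ cong (λ k → length p + k) (length-++ (tⁿ n v)) ⟩
      length p + (length (tⁿ n v) + length q)      ≤⟨ ℕ.+-mono-≤ ∣p∣≤ (ℕ.+-mono-≤ (length-tⁿ≤ n v) ∣q∣≤) ⟩
      m + (5 ^ n * length v + m)                   ∎)))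
  ... | zs , q′ , refl , _ = Factorsℤ-⊑ w {u}
    (⊑-trans {u = u} u⊑tⁿ0 (⊑-trans (tⁿ-⊑ n (⊑-trans ([] , q′ , refl) (ʳ++-⊑ zs))) (p , q , refl))) l∈

-- Search for a permutation

Repetition : List Letter → List Letter × List Letter → Set
Repetition v (y , z) = Prefix _≡_ (square-plus (y , z)) v × 0 < length y × length (y ++ z) ≤ 4 * length y

-- ⌈ p /4⌉ is the least length of y for which xxy, with x of length p, has exponent at least 9/4.
quarter : List Letter → ℕ → List Letter × List Letter
quarter v p = take ⌈ ⌈ p /2⌉ /2⌉ (take p v) , drop ⌈ ⌈ p /2⌉ /2⌉ (take p v)

Repetitive : Pred (List Letter) 0ℓ
Repetitive v = Any (λ p → Repetition v (quarter v p)) (1 ∷ 2 ∷ 3 ∷ 4 ∷ 5 ∷ [])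

repetitive? : Decidable Repetitive
repetitive? v = any? (λ p → repetition? (quarter v p)) _
  where
  repetition? : ∀ yz → Dec (Repetition v yz)
  repetition? (y , z) = prefix? Fin._≟_ _ v ×-dec (0 <? length y) ×-dec (length (y ++ z) ≤? 4 * length y)

prefixes : ℕ → List Letter → List (List Letter)
prefixes zero    _       = [ [] ]
prefixes (suc n) []      = [ [] ]
prefixes (suc n) (a ∷ u) = [] ∷ map (a ∷_) (prefixes n u)

prefixes-++ : ∀ n u → All (λ v → ∃[ r ] u ≡ v ++ r) (prefixes n u)
prefixes-++ zero    u       = (u , refl) ∷ []
prefixes-++ (suc n) []      = ([] , refl) ∷ []
prefixes-++ (suc n) (a ∷ u) = (a ∷ u , refl) ∷
  All.map⁺ (All.map (λ { (r , eq) → r , cong (a ∷_) eq }) (prefixes-++ n u))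

palindrome? : Decidable (Palindrome {Letter})
palindrome? v = reverse v ≟ʷ v

-- The search needs only a lower bound on the number of palindromes, so those of length at most 5
-- are collected, repetitions included.
short-palindromes : List Letter → List (List Letter)
short-palindromes []      = [ [] ]
short-palindromes (a ∷ u) = filter palindrome? (map (a ∷_) (prefixes 4 u)) ++ short-palindromes u

short-palindromes-sound : ∀ u → All (λ v → v ⊑ u × Palindrome v) (short-palindromes u)
short-palindromes-sound []      = (⊑-refl , refl) ∷ []
short-palindromes-sound (a ∷ u) = All.++⁺
  (All.zip (All.filter⁺ palindrome? (All.map⁺ (All.map (λ { (r , eq) → [] , r , cong (a ∷_) eq }) (prefixes-++ 4 u))) ,
            All.all-filter palindrome? (map (a ∷_) (prefixes 4 u))))
  (All.map (λ { (v⊑u , pal) → ⊑-++ˡ [ a ] v⊑u , pal }) (short-palindromes-sound u))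

-- The factors of 011, 00 and 2 include all of `six`, and also 01, which orients the cycle.
seeds : List (List Letter)
seeds = (0F ∷ 1F ∷ 1F ∷ []) ∷ (0F ∷ 0F ∷ []) ∷ (2F ∷ []) ∷ []

permutations : List (Permutation′ 3)
permutations = idₚ ∷ transpose 0F 1F ∷ transpose 0F 2F ∷ transpose 1F 2F ∷
  (transpose 0F 1F ∘ₚ transpose 0F 2F) ∷ (transpose 0F 2F ∘ₚ transpose 0F 1F) ∷ []

Seeded : Pred (List Letter) 0ℓ
Seeded v = Any (λ π → All (λ u → Infix _≡_ (map (π ⟨$⟩ʳ_) u) v) seeds) permutations

-- The first two outcomes contradict freeness and the bound on palindromes; the third supplies the
-- permutation.
Settled : Pred (List Letter) 0ℓ
Settled v = Repetitive v ⊎ 6 < length (deduplicate _≟ʷ_ (short-palindromes v)) ⊎ Seeded v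

settled? : Decidable Settled
settled? v = repetitive? v ⊎-dec (6 <? length (deduplicate _≟ʷ_ (short-palindromes v))) ⊎-dec
  any? (λ π → all? (λ u → infix? Fin._≟_ (map (π ⟨$⟩ʳ_) u) v) seeds) permutations

abstract
  settled-bar : Bar Settled 19 []
  settled-bar = step λ where
    0F → search settled? 18 [ 0F ] refl
    1F → search settled? 18 [ 1F ] refl
    2F → search settled? 18 [ 2F ] refl

-- Transfer to an arbitrary bi-infinite word

module _ (w : BiInfinite Letter) (free : Free ((+ 9) / 4) (Factorsℤ w))
         (few : HasSizeAtMost (Palindromes (Factorsℤ w)) 6) where

  seeded : ∃[ π ] All (λ u → Factorsℤ w (map (π ⟨$⟩ʳ_) u)) seeds
  seeded with Factorsℤ-extend w {[]} (+ 0 , λ ()) 19 0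
  ... | l , r , ∣l∣≡19 , _ , lr∈ with bar-suffix settled-bar l (ℕ.≤-reflexive (sym ∣l∣≡19))
  ... | zs , v , refl , _ , settled = conclude settled
    where
    factor : ∀ {u} → u ⊑ v → Factorsℤ w u
    factor {u} u⊑v = Factorsℤ-⊑ w {u} (⊑-trans {u = u} u⊑v (⊑-trans (ʳ++-⊑ zs) ([] , r , refl))) lr∈
    conclude : Settled v → ∃[ π ] All (λ u → Factorsℤ w (map (π ⟨$⟩ʳ_) u)) seeds
    conclude (inj₁ repetitive) with Any.satisfied repetitive
    ... | p , pre , 0<y , ≤4y =
      contradiction (factor ([] , Prefix⇒++ pre)) (Free-square-plus free (proj₁ (quarter v p)) (proj₂ (quarter v p)) 0<y ≤4y)
    conclude (inj₂ (inj₁ many)) = contradiction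
      (few _ (DecUnique.deduplicate-! _≟ʷ_ (short-palindromes v))
        (All.deduplicate⁺ _≟ʷ_ (All.map (λ { {u} (u⊑v , pal) → factor {u} u⊑v , pal }) (short-palindromes-sound v))))
      (ℕ.<⇒≱ many)
    conclude (inj₂ (inj₂ found)) with Any.satisfied found
    ... | π , occurs = π , All.map (λ {u} i → factor {map (π ⟨$⟩ʳ_) u} (Infix⇒⊑ i)) occurs

  factors≐ : ∃[ π ] Factorsℤ w ≐ Factors (permute π t^ω[0])
  factors≐ with seeded
  ... | π , 011∈ ∷ 00∈ ∷ 2∈ ∷ [] = π , (λ {u} → to-t^ω u) , (λ {u} → from-t^ω u)
    where
    ρ ρ⁻¹ : List Letter → List Letter
    ρ   = map (π ⟨$⟩ʳ_)
    ρ⁻¹ = map (π ⟨$⟩ˡ_)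

    ρ∘ρ⁻¹ : ∀ u → ρ (ρ⁻¹ u) ≡ u
    ρ∘ρ⁻¹ u = trans (sym (map-∘ u)) (map-id-local (All.universal (λ _ → inverseʳ π) u))

    ρ⁻¹∘ρ : ∀ u → ρ⁻¹ (ρ u) ≡ u
    ρ⁻¹∘ρ u = trans (sym (map-∘ u)) (map-id-local (All.universal (λ _ → inverseˡ π) u))

    -- Undoing the permutation makes the seeds themselves factors, so that `Oriented` applies to
    -- `w′`.
    w′ : BiInfinite Letter
    w′ = (π ⟨$⟩ˡ_) ∘ w

    relabel : ∀ u → Factorsℤ w (ρ u) → Factorsℤ w′ u
    relabel u u∈ = subst (Factorsℤ w′) (ρ⁻¹∘ρ u) (Factorsℤ-map (π ⟨$⟩ˡ_) w (ρ u) u∈)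

    unrelabel : ∀ u → Factorsℤ w′ u → Factorsℤ w (ρ u)
    unrelabel u u∈ = let i , p = Factorsℤ-map (π ⟨$⟩ʳ_) w′ u u∈ in i , prefix-cong {y = shift w i} (ρ u) (λ k → inverseʳ π) p

    sub : ∀ u v → u ⊑ v → Factorsℤ w (ρ v) → Factorsℤ w′ u
    sub u v u⊑v v∈ = relabel u (Factorsℤ-⊑ w {ρ u} (⊑-map (π ⟨$⟩ʳ_) u⊑v) v∈)

    six∈ : All (λ v → Palindromes (Factorsℤ w′) v) six
    six∈ = (sub [] [ 2F ] ([] , [ 2F ] , refl) 2∈ , refl) ∷
      (sub [ 0F ] (0F ∷ 0F ∷ []) ([] , [ 0F ] , refl) 00∈ , refl) ∷
      (sub [ 1F ] (0F ∷ 1F ∷ 1F ∷ []) ([ 0F ] , [ 1F ] , refl) 011∈ , refl) ∷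
      (relabel [ 2F ] 2∈ , refl) ∷
      (relabel (0F ∷ 0F ∷ []) 00∈ , refl) ∷
      (sub (1F ∷ 1F ∷ []) (0F ∷ 1F ∷ 1F ∷ []) ([ 0F ] , [] , refl) 011∈ , refl) ∷ []

    -- The words of `six` already exhaust the allowance, so any other palindrome would, after
    -- relabelling, be a seventh one in `w`.
    six-pal : ∀ {v} → Factorsℤ w′ v → Palindrome v → v List.∈ six
    six-pal {v} v∈ pal with DecMembership._∈?_ _≟ʷ_ v six
    ... | yes v∈six = v∈six
    ... | no  v∉six = contradiction (few (map ρ (v ∷ six))
      (Unique.map⁺ (map-injective (λ eq → trans (sym (inverseˡ π)) (trans (cong (π ⟨$⟩ˡ_) eq) (inverseˡ π))))
        (All.¬Any⇒All¬ six v∉six ∷ six-unique))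
      (All.map⁺ (All.map (λ { {u} (u∈ , pal) → unrelabel u u∈ , trans (sym (reverse-map (π ⟨$⟩ʳ_) u)) (cong ρ pal) })
        ((v∈ , pal) ∷ six∈))))
      (ℕ.<⇒≱ ℕ.≤-refl)

    free′ : ∀ y z → 0 < length y → length (y ++ z) ≤ 4 * length y → ¬ Factorsℤ w′ (square-plus (y , z))
    free′ y z 0<y ≤4y yz∈ = Free-square-plus free (ρ y) (ρ z)
      (subst (0 <_) (sym (length-map _ y)) 0<y)
      (subst₂ (λ m n → m ≤ 4 * n) (trans (sym (length-map _ (y ++ z))) (cong length (map-++ _ y z))) (sym (length-map _ y)) ≤4y)
      (subst (Factorsℤ w) (trans (map-++ _ (y ++ z) _)
        (cong₂ _++_ (map-++ _ y z) (trans (map-++ _ (y ++ z) y) (cong (_++ ρ y) (map-++ _ y z))))) (unrelabel (square-plus (y , z)) yz∈))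

    open Oriented w′ free′ six-pal (sub (0F ∷ 1F ∷ []) (0F ∷ 1F ∷ 1F ∷ []) ([] , [ 1F ] , refl) 011∈)

    to-t^ω : ∀ u → Factorsℤ w u → Factors (permute π t^ω[0]) u
    to-t^ω u u∈ = subst (Factors (permute π t^ω[0])) (ρ∘ρ⁻¹ u)
      (Factors-map (π ⟨$⟩ʳ_) t^ω[0] (ρ⁻¹ u) (factor⇒t^ω {ρ⁻¹ u} (Factorsℤ-map (π ⟨$⟩ˡ_) w u u∈)))

    from-t^ω : ∀ u → Factors (permute π t^ω[0]) u → Factorsℤ w u
    from-t^ω u u∈ = subst (Factorsℤ w) (ρ∘ρ⁻¹ u) (unrelabel (ρ⁻¹ u) (t^ω⇒factor {ρ⁻¹ u} t^ω∈))
      where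
      t^ω∈ : Factors t^ω[0] (ρ⁻¹ u)
      t^ω∈ = let n , p = Factors-map (π ⟨$⟩ˡ_) (permute π t^ω[0]) u u∈ in n , prefix-cong {y = λ k → t^ω[0] (n + k)} (ρ⁻¹ u) (λ k → inverseˡ π) p

theorem5 : HasSize (Palindromes (Factors t^ω[0])) 6
    × Free⁺ (+ 2 / 1) (Factors t^ω[0])
    × ((w : BiInfinite Letter) →
    Free (+ 9 / 4) (Factorsℤ w) →
    HasSizeAtMost (Palindromes (Factorsℤ w)) 6 →
    ∃[ π ] Factorsℤ w ≐ Factors (permute π t^ω[0]))
theorem5 = t^ω-palindromes , t^ω-Free⁺ , factors≐
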